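{- With the symmetrizers and $c$-functions defined in the context, $$\mathbf{1}_0=p_0^Xc_{w_0}^{X^{ -1}}\quad\text{and}\quad\varepsilon_0=c_{w_0}^Xe_0^X$$ in the localized affine Hecke algebra generated by the $T_i$ and $X_i^{\pm1}$, and $$\mathbf{1}_0=p_0^Yc_{w_0}^{Y}\quad\text{and}\quad\varepsilon_0=c_{w_0}^{Y^{ -1}}e_0^Y$$ in the localized affine Hecke algebra generated by the $T_i$ and $Y_i^{\pm1}$.
   Context: Let $n\ge1$ and $t^{1/2}\in\mathbb{C}^\times$, $t=(t^{1/2})^2$. Let $T_1,\ldots,T_{n-1}$ satisfy $T_iT_{i+1}T_i=T_{i+1}T_iT_{i+1}$, $T_iT_j=T_jT_i$ for $|i-j|>1$, and $T_i^2=(t^{\frac12}-t^{ -\frac12})T_i+1$. Let $H_X$ be the algebra generated by $T_1,\ldots,T_{n-1}$ and commuting invertible $X_1,\ldots,X_n$ with additional relations $X_{i+1}=T_iX_iT_i$ and $T_iX_j=X_jT_i$ for $j\notin\{i,i+1\}$. Let $H_Y$ be the algebra generated by $T_1,\ldots,T_{n-1}$ and commuting invertible $Y_1,\ldots,Y_n$ with additional relations $Y_{i+1}=T_i^{ -1}Y_iT_i^{ -1}$ and $T_iY_j=Y_jT_i$ for $j\notin\{i,i+1\}$. (Both are subalgebras of the type $GL_n$ double affine Hecke algebra.) The identities take place in the localizations of $H_X$, respectively $H_Y$, obtained by inverting all nonzero elements of $\mathbb{C}[X_1^{\pm1},\ldots,X_n^{\pm1}]$, respectively $\mathbb{C}[Y_1^{\pm1},\ldots,Y_n^{\pm1}]$.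 For $i\neq j$ let $$c^X_{ij}=\frac{t^{ -\frac12}-t^{\frac12}X_iX_j^{ -1}}{1-X_iX_j^{ -1}},\qquad c^Y_{ij}=\frac{t^{ -\frac12}-t^{\frac12}Y_iY_j^{ -1}}{1-Y_iY_j^{ -1}},$$ $c^X_{w_0}=\prod_{i<j}c^X_{ij}$, $c^Y_{w_0}=\prod_{i<j}c^Y_{ij}$, $c^{X^{ -1}}_{w_0}=\prod_{i<j}\frac{t^{ -\frac12}-t^{\frac12}X_i^{ -1}X_j}{1-X_i^{ -1}X_j}$, $c^{Y^{ -1}}_{w_0}=\prod_{i<j}\frac{t^{ -\frac12}-t^{\frac12}Y_i^{ -1}Y_j}{1-Y_i^{ -1}Y_j}$ (products over $1\le i<j\le n$). With $C_{s_i}=T_i+t^{ -\frac12}$, the normalized intertwiners are $$\xi_{s_i}=\frac1{c^X_{i,i+1}}\big(C_{s_i}-c^X_{i+1,i}\big),\qquad \eta_{s_i}=\frac1{c^Y_{i+1,i}}\big(C_{s_i}-c^Y_{i,i+1}\big).$$ For $w\in S_n$ with reduced word $w=s_{i_1}\cdots s_{i_\ell}$ (where $s_i=(i,i+1)$) put $T_w=T_{i_1}\cdots T_{i_\ell}$, $\xi_w=\xi_{s_{i_1}}\cdots\xi_{s_{i_\ell}}$, $\eta_w=\eta_{s_{i_1}}\cdots\eta_{s_{i_\ell}}$ (independent of the reduced word). Let $w_0$ be the longest element of $S_n$, $\ell$ the length, and $$p_0^X=\sum_{w\in S_n}\xi_w,\quad e_0^X=\sum_{w\in S_n}(-1)^{\ell(w)-\ell(w_0)}\xi_w,\quad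 p_0^Y=\sum_{w\in S_n}\eta_w,\quad e_0^Y=\sum_{w\in S_n}(-1)^{\ell(w)-\ell(w_0)}\eta_w,$$ $$\mathbf{1}_0=\sum_{w\in S_n}(t^{\frac12})^{\ell(w)-\ell(w_0)}T_w,\qquad\varepsilon_0=\sum_{w\in S_n}(-t^{ -\frac12})^{\ell(w)-\ell(w_0)}T_w .$$ -}

module Defs where

open import Level using (_⊔_)
open import Algebra.Apartness.Bundles using (HeytingField; HeytingCommutativeRing)
open import Algebra.Bundles using (Ring; CommutativeRing; Semiring)
open import Data.Bool.Base using (if_then_else_)
open import Data.Fin.Base as Fin using (Fin; zero; suc; toℕ; inject₁; punchIn; opposite)
import Data.Fin.Properties as Fin
open import Data.Fin.Permutation using (Permutation′; _⟨$⟩ʳ_; transpose; insert; remove; reverse; _∘ₚ_)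
import Data.Fin.Permutation as Perm
open import Data.Integer.Base as ℤ using (ℤ; +_; -[1+_])
import Data.Integer.Properties as ℤ
open import Data.List.Base as List using (List; []; _∷_; _++_; [_]; map; concatMap; foldr; length; allFin)
open import Data.List.Properties using (length-++; length-map)
open import Data.List.Relation.Unary.Any as Any using (Any; here)
import Data.List.Relation.Unary.Any.Properties as Any
open import Data.List.Relation.Unary.All as All using (All; [])
import Data.List.Relation.Unary.All.Properties as All
open import Data.List.Relation.Unary.AllPairs as AllPairs using (AllPairs; []; _∷_)
import Data.List.Relation.Unary.AllPairs.Properties as AllPairs
open import Data.List.Membership.Propositional.Properties using (∈-allFin)
open import Data.List.Relation.Unary.Unique.Propositional.Properties using (allFin⁺)
open import Data.Nat.Base as ℕ using (ℕ; zero; suc; z≤n; s≤s; ∣_-_∣)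
import Data.Nat.Properties as ℕ
open import Data.Product.Base using (Σ; ∃; _×_; _,_; proj₁; proj₂)
open import Data.Vec.Base as Vec using (Vec; tabulate; zipWith; replicate; lookup)
import Data.Vec.Properties as Vec
open import Function.Base using (_∘_)
open import Relation.Binary.Core using (Rel)
open import Relation.Binary.PropositionalEquality
  using (_≡_; _≢_; refl; sym; trans; cong; cong₂; subst; module ≡-Reasoning)
open import Relation.Nullary using (¬_; yes; no; does)
open import Relation.Nullary.Decidable using (dec-true; dec-false)
import Algebra.Definitions.RawSemiring as Powers
import Algebra.Apartness.Properties.HeytingCommutativeRing as Apartness
import Algebra.Properties.Ring as RingProperties
import Relation.Binary.Reasoning.Setoid as SetoidReasoning

------------------------------------------------------------------------
-- The symmetric group S_n, for n = suc m

s : ∀ {m} → Fin m → Permutation′ (suc m)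
s i = transpose (inject₁ i) (suc i)

Word : ℕ → Set
Word m = List (Fin m)

-- The product s_{i₁} ⋯ s_{iₗ} as a composite of functions, the last letter
-- acting first.  The library's _∘ₚ_ composes in diagrammatic order.
⟦_⟧ : ∀ {m} → Word m → Permutation′ (suc m)
⟦ [] ⟧    = Perm.id
⟦ i ∷ v ⟧ = ⟦ v ⟧ ∘ₚ s i

record ReducedWord {m} (w : Permutation′ (suc m)) : Set where
  field
    word      : Word m
    evaluates : ⟦ word ⟧ Perm.≈ w
    minimal   : ∀ v → ⟦ v ⟧ Perm.≈ w → length word ℕ.≤ length v

elements : ∀ n → List (Permutation′ n)
elements zero    = [ Perm.id ]
elements (suc n) = concatMap (λ k → map (insert zero k) (elements n)) (allFin (suc n))

-- The letters k-1, …, 1, 0: the product s_{k-1} ⋯ s₁ s₀ sends 0 to k and is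
-- increasing on the remaining points.
descent : ∀ {m} → Fin (suc m) → Word m
descent {m}     zero    = []
descent {suc m} (suc k) = map suc (descent k) ++ [ zero ]

canonicalWord : ∀ {m} → Permutation′ (suc m) → Word m
canonicalWord {zero}  w = []
canonicalWord {suc m} w = descent (w ⟨$⟩ʳ zero) ++ map suc (canonicalWord (remove zero w))

remove-cong : ∀ {n} {v w : Permutation′ (suc n)} → v Perm.≈ w →
              remove zero v Perm.≈ remove zero w
remove-cong {v = v} {w} eq i = Fin.punchIn-injective (v ⟨$⟩ʳ zero) _ _ (begin
  punchIn (v ⟨$⟩ʳ zero) (remove zero v ⟨$⟩ʳ i) ≡⟨ Perm.punchIn-permute v zero i ⟨
  v ⟨$⟩ʳ suc i                                 ≡⟨ eq (suc i) ⟩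
  w ⟨$⟩ʳ suc i                                 ≡⟨ Perm.punchIn-permute w zero i ⟩
  punchIn (w ⟨$⟩ʳ zero) (remove zero w ⟨$⟩ʳ i) ≡⟨ cong (λ k → punchIn k (remove zero w ⟨$⟩ʳ i)) (eq zero) ⟨
  punchIn (v ⟨$⟩ʳ zero) (remove zero w ⟨$⟩ʳ i) ∎)
  where open ≡-Reasoning

canonicalWord-cong : ∀ {m} {v w : Permutation′ (suc m)} → v Perm.≈ w →
                     canonicalWord v ≡ canonicalWord w
canonicalWord-cong {zero}  eq = refl
canonicalWord-cong {suc m} {v} {w} eq =
  cong₂ (λ k u → descent k ++ map suc u) (eq zero)
    (canonicalWord-cong {v = remove zero v} {remove zero w} (remove-cong {v = v} {w} eq))

s-suc : ∀ {m} (i : Fin m) (x : Fin (suc m)) → s (suc i) ⟨$⟩ʳ suc x ≡ suc (s i ⟨$⟩ʳ x)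
s-suc i x = Perm.lift₀-transpose (inject₁ i) (suc i) (suc x)

⟦++⟧ : ∀ {m} (u v : Word m) x → ⟦ u ++ v ⟧ ⟨$⟩ʳ x ≡ ⟦ u ⟧ ⟨$⟩ʳ (⟦ v ⟧ ⟨$⟩ʳ x)
⟦++⟧ []      v x = refl
⟦++⟧ (i ∷ u) v x = cong (s i ⟨$⟩ʳ_) (⟦++⟧ u v x)

⟦map-suc⟧-zero : ∀ {m} (u : Word m) → ⟦ map suc u ⟧ ⟨$⟩ʳ zero ≡ zero
⟦map-suc⟧-zero []      = refl
⟦map-suc⟧-zero (i ∷ u) rewrite ⟦map-suc⟧-zero u = refl

⟦map-suc⟧-suc : ∀ {m} (u : Word m) x → ⟦ map suc u ⟧ ⟨$⟩ʳ suc x ≡ suc (⟦ u ⟧ ⟨$⟩ʳ x)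
⟦map-suc⟧-suc []      x = refl
⟦map-suc⟧-suc (i ∷ u) x rewrite ⟦map-suc⟧-suc u x = s-suc i (⟦ u ⟧ ⟨$⟩ʳ x)

descent-zero : ∀ {m} (k : Fin (suc m)) → ⟦ descent k ⟧ ⟨$⟩ʳ zero ≡ k
descent-zero {m}     zero    = refl
descent-zero {suc m} (suc k) = begin
  ⟦ map suc (descent k) ++ [ zero ] ⟧ ⟨$⟩ʳ zero ≡⟨ ⟦++⟧ (map suc (descent k)) [ zero ] zero ⟩
  ⟦ map suc (descent k) ⟧ ⟨$⟩ʳ suc zero         ≡⟨ ⟦map-suc⟧-suc (descent k) zero ⟩
  suc (⟦ descent k ⟧ ⟨$⟩ʳ zero)                 ≡⟨ cong suc (descent-zero k) ⟩
  suc k                                         ∎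
  where open ≡-Reasoning

descent-suc : ∀ {m} (k : Fin (suc m)) (x : Fin m) → ⟦ descent k ⟧ ⟨$⟩ʳ suc x ≡ punchIn k x
descent-suc {suc m} zero    x       = refl
descent-suc {suc m} (suc k) zero    =
  trans (⟦++⟧ (map suc (descent k)) [ zero ] (suc zero)) (⟦map-suc⟧-zero (descent k))
descent-suc {suc m} (suc k) (suc x) = begin
  ⟦ map suc (descent k) ++ [ zero ] ⟧ ⟨$⟩ʳ suc (suc x) ≡⟨ ⟦++⟧ (map suc (descent k)) [ zero ] (suc (suc x)) ⟩
  ⟦ map suc (descent k) ⟧ ⟨$⟩ʳ suc (suc x)             ≡⟨ ⟦map-suc⟧-suc (descent k) (suc x) ⟩
  suc (⟦ descent k ⟧ ⟨$⟩ʳ suc x)                       ≡⟨ cong suc (descent-suc k x) ⟩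
  suc (punchIn k x)                                    ∎
  where open ≡-Reasoning

canonicalWord-evaluates : ∀ {m} (w : Permutation′ (suc m)) → ⟦ canonicalWord w ⟧ Perm.≈ w
canonicalWord-evaluates {zero} w zero with w ⟨$⟩ʳ zero
... | zero = refl
canonicalWord-evaluates {suc m} w x =
  trans (⟦++⟧ (descent k) (map suc u) x) (helper x)
  where
  k = w ⟨$⟩ʳ zero
  u = canonicalWord (remove zero w)
  helper : ∀ x → ⟦ descent k ⟧ ⟨$⟩ʳ (⟦ map suc u ⟧ ⟨$⟩ʳ x) ≡ w ⟨$⟩ʳ x
  helper zero rewrite ⟦map-suc⟧-zero u = descent-zero k
  helper (suc x) rewrite ⟦map-suc⟧-suc u x = begin
    ⟦ descent k ⟧ ⟨$⟩ʳ suc (⟦ u ⟧ ⟨$⟩ʳ x) ≡⟨ descent-suc k _ ⟩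
    punchIn k (⟦ u ⟧ ⟨$⟩ʳ x)              ≡⟨ cong (punchIn k) (canonicalWord-evaluates (remove zero w) x) ⟩
    punchIn k (remove zero w ⟨$⟩ʳ x)      ≡⟨ Perm.punchIn-permute w zero x ⟨
    w ⟨$⟩ʳ suc x                          ∎
    where open ≡-Reasoning

length-descent : ∀ {m} (k : Fin (suc m)) → length (descent k) ≡ toℕ k
length-descent {m}     zero    = refl
length-descent {suc m} (suc k) = begin
  length (map suc (descent k) ++ [ zero ])  ≡⟨ length-++ (map suc (descent k)) ⟩
  length (map suc (descent k)) ℕ.+ 1        ≡⟨ ℕ.+-comm _ 1 ⟩
  suc (length (map suc (descent k)))        ≡⟨ cong suc (length-map suc (descent k)) ⟩
  suc (length (descent k))                  ≡⟨ cong suc (length-descent k) ⟩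
  suc (toℕ k)                               ∎
  where open ≡-Reasoning

len : ∀ {m} → Permutation′ (suc m) → ℕ
len w = length (canonicalWord w)

len-step : ∀ {m} (w : Permutation′ (suc (suc m))) →
           len w ≡ toℕ (w ⟨$⟩ʳ zero) ℕ.+ len (remove zero w)
len-step w = trans (length-++ (descent (w ⟨$⟩ʳ zero)))
  (cong₂ ℕ._+_ (length-descent (w ⟨$⟩ʳ zero)) (length-map suc (canonicalWord (remove zero w))))

len-cong : ∀ {m} {v w : Permutation′ (suc m)} → v Perm.≈ w → len v ≡ len w
len-cong {v = v} {w} eq = cong length (canonicalWord-cong {v = v} {w} eq)

-- How s_i moves the value k = w(0), and which permutation is left after
-- removing the point 0.
data Effect {m} : Fin (suc m) → Fin (suc (suc m)) → Set where
  same  : ∀ {i k} (j : Fin m) → s i ⟨$⟩ʳ k ≡ k →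
          (∀ x → s i ⟨$⟩ʳ punchIn k x ≡ punchIn k (s j ⟨$⟩ʳ x)) → Effect i k
  moved : ∀ {i k} → toℕ (s i ⟨$⟩ʳ k) ℕ.≤ suc (toℕ k) →
          (∀ x → s i ⟨$⟩ʳ punchIn k x ≡ punchIn (s i ⟨$⟩ʳ k) x) → Effect i k

effect : ∀ {m} (i : Fin (suc m)) (k : Fin (suc (suc m))) → Effect i k
effect zero zero          = moved (s≤s z≤n) λ { zero → refl ; (suc x) → refl }
effect zero (suc zero)    = moved z≤n λ { zero → refl ; (suc x) → refl }
effect {suc m} zero (suc (suc k)) =
  same zero refl λ { zero → refl ; (suc zero) → refl ; (suc (suc x)) → refl }
effect {suc m} (suc i) zero = same i refl (s-suc i)
effect {suc m} (suc i) (suc k) with effect i k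
... | same j fixes commutes =
      same (suc j) (trans (s-suc i k) (cong suc fixes))
        λ { zero → refl
          ; (suc x) → trans (s-suc i (punchIn k x))
              (trans (cong suc (commutes x)) (cong (punchIn (suc k)) (sym (s-suc j x)))) }
... | moved bound commutes =
      moved (subst (λ y → toℕ y ℕ.≤ suc (suc (toℕ k))) (sym (s-suc i k)) (s≤s bound))
        λ { zero → cong (λ y → punchIn y zero) (sym (s-suc i k))
          ; (suc x) → trans (s-suc i (punchIn k x))
              (trans (cong suc (commutes x)) (cong (λ y → punchIn y (suc x)) (sym (s-suc i k)))) }

len-s : ∀ {m} (i : Fin m) (w : Permutation′ (suc m)) → len (w ∘ₚ s i) ℕ.≤ suc (len w)
len-s {suc m} i w = begin
  len (w ∘ₚ s i)                                       ≡⟨ len-step (w ∘ₚ s i) ⟩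
  toℕ (s i ⟨$⟩ʳ k) ℕ.+ len (remove zero (w ∘ₚ s i))    ≤⟨ helper (effect i k) ⟩
  suc (toℕ k ℕ.+ len w′)                               ≡⟨ cong suc (len-step w) ⟨
  suc (len w)                                          ∎
  where
  open ℕ.≤-Reasoning
  k  = w ⟨$⟩ʳ zero
  w′ = remove zero w
  removed : (v : Permutation′ (suc m)) →
            (∀ x → s i ⟨$⟩ʳ punchIn k (w′ ⟨$⟩ʳ x) ≡ punchIn (s i ⟨$⟩ʳ k) (v ⟨$⟩ʳ x)) →
            remove zero (w ∘ₚ s i) Perm.≈ v
  removed v eq x = Fin.punchIn-injective (s i ⟨$⟩ʳ k) _ _
    (trans (sym (Perm.punchIn-permute (w ∘ₚ s i) zero x))
      (trans (cong (s i ⟨$⟩ʳ_) (Perm.punchIn-permute w zero x)) (eq x)))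
  helper : Effect i k →
           toℕ (s i ⟨$⟩ʳ k) ℕ.+ len (remove zero (w ∘ₚ s i)) ℕ.≤ suc (toℕ k ℕ.+ len w′)
  helper (same j fixes commutes) = begin
    toℕ (s i ⟨$⟩ʳ k) ℕ.+ len (remove zero (w ∘ₚ s i))
      ≡⟨ cong₂ ℕ._+_ (cong toℕ fixes) (len-cong {v = remove zero (w ∘ₚ s i)} {w′ ∘ₚ s j}
           (removed (w′ ∘ₚ s j) λ x →
             trans (commutes _) (cong (λ y → punchIn y (s j ⟨$⟩ʳ (w′ ⟨$⟩ʳ x))) (sym fixes)))) ⟩
    toℕ k ℕ.+ len (w′ ∘ₚ s j)  ≤⟨ ℕ.+-monoʳ-≤ (toℕ k) (len-s j w′) ⟩
    toℕ k ℕ.+ suc (len w′)     ≡⟨ ℕ.+-suc (toℕ k) (len w′) ⟩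
    suc (toℕ k ℕ.+ len w′)     ∎
  helper (moved bound commutes) = begin
    toℕ (s i ⟨$⟩ʳ k) ℕ.+ len (remove zero (w ∘ₚ s i))
      ≡⟨ cong (toℕ (s i ⟨$⟩ʳ k) ℕ.+_) (len-cong {v = remove zero (w ∘ₚ s i)} {w′}
           (removed w′ λ x → commutes _)) ⟩
    toℕ (s i ⟨$⟩ʳ k) ℕ.+ len w′  ≤⟨ ℕ.+-monoˡ-≤ (len w′) bound ⟩
    suc (toℕ k ℕ.+ len w′)       ∎

len-id : ∀ m → len (Perm.id {suc m}) ≡ 0
len-id zero    = refl
len-id (suc m) = trans (len-step (Perm.id {suc (suc m)}))
  (trans (len-cong {v = remove zero (Perm.id {suc (suc m)})} {Perm.id} (λ _ → refl)) (len-id m))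

len-minimal : ∀ {m} (v : Word m) → len ⟦ v ⟧ ℕ.≤ length v
len-minimal {m} []      = ℕ.≤-reflexive (len-id m)
len-minimal     (i ∷ v) = ℕ.≤-trans (len-s i ⟦ v ⟧) (s≤s (len-minimal v))

reducedWord : ∀ {m} (w : Permutation′ (suc m)) → ReducedWord w
reducedWord w = record
  { word      = canonicalWord w
  ; evaluates = canonicalWord-evaluates w
  ; minimal   = λ v eq → subst (ℕ._≤ length v) (len-cong {v = ⟦ v ⟧} {w} eq) (len-minimal v)
  }

ℓ : ∀ {m} → Permutation′ (suc m) → ℕ
ℓ w = length (ReducedWord.word (reducedWord w))

w₀ : ∀ {n} → Permutation′ n
w₀ = reverse

w₀-longest : ∀ {m} (w : Permutation′ (suc m)) → ℓ w ℕ.≤ ℓ (w₀ {suc m})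
w₀-longest {zero}  w = z≤n
w₀-longest {suc m} w = begin
  ℓ w                                       ≡⟨ len-step w ⟩
  toℕ (w ⟨$⟩ʳ zero) ℕ.+ ℓ (remove zero w)   ≤⟨ ℕ.+-mono-≤ (Fin.toℕ≤pred[n] (w ⟨$⟩ʳ zero)) (w₀-longest (remove zero w)) ⟩
  suc m ℕ.+ ℓ (w₀ {suc m})                  ≡⟨ cong₂ ℕ._+_ (sym (Fin.toℕ-fromℕ (suc m))) (len-cong {v = w₀} {remove zero w₀′} removed) ⟩
  toℕ (w₀′ ⟨$⟩ʳ zero) ℕ.+ ℓ (remove zero w₀′) ≡⟨ len-step w₀′ ⟨
  ℓ w₀′                                     ∎
  where
  open ℕ.≤-Reasoning
  w₀′ = w₀ {suc (suc m)}
  punchIn-last : ∀ {n} (x : Fin n) → punchIn (Fin.fromℕ n) x ≡ inject₁ x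
  punchIn-last zero    = refl
  punchIn-last (suc x) = cong suc (punchIn-last x)
  removed : w₀ {suc m} Perm.≈ remove zero w₀′
  removed x = Fin.punchIn-injective (Fin.fromℕ (suc m)) _ _
    (trans (punchIn-last (opposite x)) (Perm.punchIn-permute w₀′ zero x))

elements-complete : ∀ {n} (w : Permutation′ n) → Any (w Perm.≈_) (elements n)
elements-complete {zero}  w = here λ ()
elements-complete {suc n} w =
  Any.concatMap⁺ (λ k → map (insert zero k) (elements n))
    (Any.map (λ { refl → Any.map⁺ (Any.map match (elements-complete (remove zero w))) })
      (∈-allFin (w ⟨$⟩ʳ zero)))
  where
  match : ∀ {v} → remove zero w Perm.≈ v → w Perm.≈ insert zero (w ⟨$⟩ʳ zero) v
  match     eq zero    = refl
  match {v} eq (suc x) = trans (Perm.punchIn-permute w zero x)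
    (trans (cong (punchIn (w ⟨$⟩ʳ zero)) (eq x)) (sym (Perm.insert-punchIn zero (w ⟨$⟩ʳ zero) v x)))

elements-distinct : ∀ n → AllPairs (λ v w → ¬ (v Perm.≈ w)) (elements n)
elements-distinct zero    = [] ∷ []
elements-distinct (suc n) = AllPairs.concat⁺
  (All.map⁺ (All.universal (λ k → AllPairs.map⁺ (AllPairs.map (λ {v} {w} → within k {v} {w})
    (elements-distinct n))) _))
  (AllPairs.map⁺ (AllPairs.map across (allFin⁺ (suc n))))
  where
  within : ∀ k {v w} → ¬ (v Perm.≈ w) → ¬ (insert zero k v Perm.≈ insert zero k w)
  within k {v} {w} v≉w eq = v≉w λ x → Fin.punchIn-injective k _ _
    (trans (sym (Perm.insert-punchIn zero k v x))
      (trans (eq (suc x)) (Perm.insert-punchIn zero k w x)))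
  across : ∀ {k k′} → k ≢ k′ →
           All (λ v → All (λ w → ¬ (v Perm.≈ w)) (map (insert zero k′) (elements n)))
               (map (insert zero k) (elements n))
  across k≢k′ = All.map⁺ (All.universal
    (λ v → All.map⁺ (All.universal (λ w eq → k≢k′ (eq zero)) _)) _)

------------------------------------------------------------------------
-- Rings presented by generators and relations

infixl 6 _⊕_
infixl 7 _⊛_
infix  8 ⊖_

data Expr {g} (G : Set g) : Set g where
  gen     : G → Expr G
  𝟘 𝟙     : Expr G
  _⊕_ _⊛_ : Expr G → Expr G → Expr G
  ⊖_      : Expr G → Expr G

module Presented {g r} {G : Set g} (R : Rel (Expr G) r) where

  infix 4 _≋_

  data _≋_ : Rel (Expr G) (g ⊔ r) where
    relation : ∀ {x y} → R x y → x ≋ y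
    ≋-refl   : ∀ {x} → x ≋ x
    ≋-sym    : ∀ {x y} → x ≋ y → y ≋ x
    ≋-trans  : ∀ {x y z} → x ≋ y → y ≋ z → x ≋ z
    ⊕-cong   : ∀ {x x′ y y′} → x ≋ x′ → y ≋ y′ → x ⊕ y ≋ x′ ⊕ y′
    ⊛-cong   : ∀ {x x′ y y′} → x ≋ x′ → y ≋ y′ → x ⊛ y ≋ x′ ⊛ y′
    ⊖-cong   : ∀ {x x′} → x ≋ x′ → ⊖ x ≋ ⊖ x′
    ⊕-assoc  : ∀ x y z → (x ⊕ y) ⊕ z ≋ x ⊕ (y ⊕ z)
    ⊕-comm   : ∀ x y → x ⊕ y ≋ y ⊕ x
    ⊕-idˡ    : ∀ x → 𝟘 ⊕ x ≋ x
    ⊖-invˡ   : ∀ x → ⊖ x ⊕ x ≋ 𝟘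
    ⊛-assoc  : ∀ x y z → (x ⊛ y) ⊛ z ≋ x ⊛ (y ⊛ z)
    ⊛-idˡ    : ∀ x → 𝟙 ⊛ x ≋ x
    ⊛-idʳ    : ∀ x → x ⊛ 𝟙 ≋ x
    distribˡ : ∀ x y z → x ⊛ (y ⊕ z) ≋ (x ⊛ y) ⊕ (x ⊛ z)
    distribʳ : ∀ x y z → (y ⊕ z) ⊛ x ≋ (y ⊛ x) ⊕ (z ⊛ x)

  ring : Ring g (g ⊔ r)
  ring = record
    { Carrier = Expr G
    ; _≈_ = _≋_
    ; _+_ = _⊕_
    ; _*_ = _⊛_
    ; -_  = ⊖_
    ; 0#  = 𝟘
    ; 1#  = 𝟙
    ; isRing = record
      { +-isAbelianGroup = record
        { isGroup = record
          { isMonoid = record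
            { isSemigroup = record
              { isMagma = record
                { isEquivalence = record { refl = ≋-refl ; sym = ≋-sym ; trans = ≋-trans }
                ; ∙-cong = ⊕-cong }
              ; assoc = ⊕-assoc }
            ; identity = ⊕-idˡ , λ x → ≋-trans (⊕-comm x 𝟘) (⊕-idˡ x) }
          ; inverse = ⊖-invˡ , λ x → ≋-trans (⊕-comm x (⊖ x)) (⊖-invˡ x)
          ; ⁻¹-cong = ⊖-cong }
        ; comm = ⊕-comm }
      ; *-cong = ⊛-cong
      ; *-assoc = ⊛-assoc
      ; *-identity = ⊛-idˡ , ⊛-idʳ
      ; distrib = distribˡ , distribʳ
      }
    }

------------------------------------------------------------------------
-- The localization of a (not necessarily commutative) ring A at a family d
-- of elements: the universal ring under A in which every d i is invertible.
-- When the d i form an Ore set this is the ring of fractions.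

module Localization {a ℓ i} (A : Ring a ℓ) {I : Set i} (d : I → Ring.Carrier A) where
  private module A = Ring A

  data Generator : Set (a ⊔ i) where
    ι   : A.Carrier → Generator
    inv : I → Generator

  data Relation : Rel (Expr Generator) (a ⊔ ℓ ⊔ i) where
    ι-cong : ∀ {x y} → x A.≈ y → Relation (gen (ι x)) (gen (ι y))
    ι-+    : ∀ x y → Relation (gen (ι (x A.+ y))) (gen (ι x) ⊕ gen (ι y))
    ι-*    : ∀ x y → Relation (gen (ι (x A.* y))) (gen (ι x) ⊛ gen (ι y))
    ι-1    : Relation (gen (ι A.1#)) 𝟙
    invˡ   : ∀ k → Relation (gen (inv k) ⊛ gen (ι (d k))) 𝟙
    invʳ   : ∀ k → Relation (gen (ι (d k)) ⊛ gen (inv k)) 𝟙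

  open Presented Relation public using (ring)

module ListOps {a ℓ} (A : Ring a ℓ) where
  open Ring A

  sum product : List Carrier → Carrier
  sum     = foldr _+_ 0#
  product = foldr _*_ 1#

------------------------------------------------------------------------
-- Affine Hecke algebras over a field K, for n = suc m.  A Heyting field is the
-- constructive form of a field: x # y says that x and y are distinct,
-- positively (x - y is invertible); with excluded middle it is ¬ (x ≈ y).

module AffineHecke {ℓ₀ ℓ₁ ℓ₂} (K : HeytingField ℓ₀ ℓ₁ ℓ₂)
  (t½ : HeytingField.Carrier K) (t½#0 : HeytingField._#_ K t½ (HeytingField.0# K)) (m : ℕ) where

  module K = HeytingField K
  open K using (Carrier; _≈_; _#_; _+_; _*_; -_; _-_; 0#; 1#)
  open Apartness K.heytingCommutativeRing using (1#0; #-congʳ; invertibleˡ⇒#; x-0≈x)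
  module Kᶜ = CommutativeRing (HeytingCommutativeRing.commutativeRing K.heytingCommutativeRing)
  open Powers (Semiring.rawSemiring Kᶜ.semiring) using (_^_)

  t⁻½ : Carrier
  t⁻½ = proj₁ (K.#⇒invertible t½#0)

  t½*t⁻½≈1 : t½ * t⁻½ ≈ 1#
  t½*t⁻½≈1 = K.trans (K.*-congʳ (K.sym (x-0≈x t½))) (proj₂ (proj₂ (K.#⇒invertible t½#0)))

  t⁻½#0 : t⁻½ # 0#
  t⁻½#0 = invertibleˡ⇒# (t½ , K.trans (K.*-congˡ (x-0≈x t⁻½)) t½*t⁻½≈1)

  -- zpow u u⁻¹ k is the k-th power of the unit u with inverse u⁻¹.
  zpow : Carrier → Carrier → ℤ → Carrier
  zpow u u⁻¹ (+ k)    = u ^ k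
  zpow u u⁻¹ -[1+ k ] = u⁻¹ ^ suc k

  Exponent : Set
  Exponent = Vec ℤ (suc m)

  -- Laurent polynomials in n variables, as finite sums of terms a z^e.  Terms
  -- with the same exponent may occur several times: such a list stands for the
  -- Laurent polynomial whose coefficients are given by the next function.
  Laurent : Set ℓ₀
  Laurent = List (Carrier × Exponent)

  coefficient : Laurent → Exponent → Carrier
  coefficient f e = ListOps.sum Kᶜ.ring
    (map (λ (a , e′) → if does (Vec.≡-dec ℤ._≟_ e′ e) then a else 0#) f)

  Nonzero : Laurent → Set ℓ₂
  Nonzero f = ∃ λ e → coefficient f e # 0#

  δ : Fin (suc m) → Exponent
  δ i = tabulate λ k → if does (k Fin.≟ i) then + 1 else + 0

  δ-δ : Fin (suc m) → Fin (suc m) → Exponent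
  δ-δ i j = zipWith ℤ._-_ (δ i) (δ j)

  -- a - b z_i z_j⁻¹
  binomial : Carrier → Carrier → Fin (suc m) → Fin (suc m) → Laurent
  binomial a b i j = (a , replicate (suc m) (+ 0)) ∷ (- b , δ-δ i j) ∷ []

  binomial-nonzero : ∀ {a b i j} → a # 0# → i ≢ j → Nonzero (binomial a b i j)
  binomial-nonzero {a} {b} {i} {j} a#0 i≢j = e₀ , #-congʳ (K.sym coefficient≈a) a#0
    where
    e₀ = replicate (suc m) (+ 0)

    lookup-δ-δ : lookup (δ-δ i j) i ≡ + 1
    lookup-δ-δ
      rewrite Vec.lookup-zipWith ℤ._-_ i (δ i) (δ j)
            | Vec.lookup∘tabulate (λ k → if does (k Fin.≟ i) then + 1 else + 0) i
            | Vec.lookup∘tabulate (λ k → if does (k Fin.≟ j) then + 1 else + 0) i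
            | dec-true (i Fin.≟ i) refl
            | dec-false (i Fin.≟ j) i≢j = refl

    δ-δ≢e₀ : δ-δ i j ≢ e₀
    δ-δ≢e₀ eq with trans (sym lookup-δ-δ) (trans (cong (λ v → lookup v i) eq) (Vec.lookup-replicate i (+ 0)))
    ... | ()

    coefficient≈a : coefficient (binomial a b i j) e₀ ≈ a
    coefficient≈a
      rewrite dec-true (Vec.≡-dec ℤ._≟_ e₀ e₀) refl
            | dec-false (Vec.≡-dec ℤ._≟_ (δ-δ i j) e₀) δ-δ≢e₀
      = K.trans (K.+-congˡ (K.+-identityˡ 0#)) (K.+-identityʳ a)

  data Side : Set where
    X Y : Side

  -- H_X and H_Y have the same generators (Z stands for X, respectively Y) and
  -- differ only in how T_i carries Z_i to Z_{i+1}.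
  data Generator : Set ℓ₀ where
    scalar : Carrier → Generator
    T      : Fin m → Generator
    Z Z⁻¹  : Fin (suc m) → Generator

  -- T_i - (t^½ - t^-½), the inverse of T_i by the quadratic relation.
  T⁻¹ : Fin m → Expr Generator
  T⁻¹ i = gen (T i) ⊕ ⊖ gen (scalar (t½ - t⁻½))

  data HeckeRelation : Side → Rel (Expr Generator) (ℓ₀ ⊔ ℓ₁) where

    scalar-cong    : ∀ {v a b} → a ≈ b → HeckeRelation v (gen (scalar a)) (gen (scalar b))
    scalar-+       : ∀ {v} a b → HeckeRelation v (gen (scalar (a + b))) (gen (scalar a) ⊕ gen (scalar b))
    scalar-*       : ∀ {v} a b → HeckeRelation v (gen (scalar (a * b))) (gen (scalar a) ⊛ gen (scalar b))
    scalar-1       : ∀ {v} → HeckeRelation v (gen (scalar 1#)) 𝟙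
    scalar-central : ∀ {v} a g → HeckeRelation v (gen (scalar a) ⊛ gen g) (gen g ⊛ gen (scalar a))

    braid     : ∀ {v} i j → toℕ j ≡ suc (toℕ i) →
                HeckeRelation v (gen (T i) ⊛ gen (T j) ⊛ gen (T i)) (gen (T j) ⊛ gen (T i) ⊛ gen (T j))
    far       : ∀ {v} i j → 1 ℕ.< ∣ toℕ i - toℕ j ∣ →
                HeckeRelation v (gen (T i) ⊛ gen (T j)) (gen (T j) ⊛ gen (T i))
    quadratic : ∀ {v} i →
                HeckeRelation v (gen (T i) ⊛ gen (T i)) (gen (scalar (t½ - t⁻½)) ⊛ gen (T i) ⊕ 𝟙)

    Z-comm    : ∀ {v} i j → HeckeRelation v (gen (Z i) ⊛ gen (Z j)) (gen (Z j) ⊛ gen (Z i))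
    Z-invˡ    : ∀ {v} i → HeckeRelation v (gen (Z⁻¹ i) ⊛ gen (Z i)) 𝟙
    Z-invʳ    : ∀ {v} i → HeckeRelation v (gen (Z i) ⊛ gen (Z⁻¹ i)) 𝟙

    T-Z       : ∀ {v} i j → j ≢ inject₁ i → j ≢ suc i →
                HeckeRelation v (gen (T i) ⊛ gen (Z j)) (gen (Z j) ⊛ gen (T i))
    T-X-T     : ∀ i → HeckeRelation X (gen (Z (suc i))) (gen (T i) ⊛ gen (Z (inject₁ i)) ⊛ gen (T i))
    T⁻¹-Y-T⁻¹ : ∀ i → HeckeRelation Y (gen (Z (suc i))) (T⁻¹ i ⊛ gen (Z (inject₁ i)) ⊛ T⁻¹ i)

  H : Side → Ring ℓ₀ (ℓ₀ ⊔ ℓ₁)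
  H v = Presented.ring (HeckeRelation v)

  T⁻¹-inverseˡ : ∀ v i → Ring._≈_ (H v) (T⁻¹ i ⊛ gen (T i)) 𝟙
  T⁻¹-inverseˡ v i = begin
    (τ ⊕ ⊖ κ) ⊛ τ            ≈⟨ H.distribʳ τ τ (⊖ κ) ⟩
    τ ⊛ τ ⊕ ⊖ κ ⊛ τ          ≈⟨ H.+-cong (Presented.relation (quadratic i)) (H.sym (-‿distribˡ-* κ τ)) ⟩
    (κ ⊛ τ ⊕ 𝟙) ⊕ ⊖ (κ ⊛ τ)  ≈⟨ H.+-congʳ (H.+-comm (κ ⊛ τ) 𝟙) ⟩
    (𝟙 ⊕ κ ⊛ τ) ⊕ ⊖ (κ ⊛ τ)  ≈⟨ H.+-assoc 𝟙 (κ ⊛ τ) (⊖ (κ ⊛ τ)) ⟩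
    𝟙 ⊕ (κ ⊛ τ ⊕ ⊖ (κ ⊛ τ))  ≈⟨ H.+-congˡ (H.-‿inverseʳ (κ ⊛ τ)) ⟩
    𝟙 ⊕ 𝟘                    ≈⟨ H.+-identityʳ 𝟙 ⟩
    𝟙                        ∎
    where
    module H = Ring (H v)
    open RingProperties (H v) using (-‿distribˡ-*)
    open SetoidReasoning H.setoid
    τ = gen (T i)
    κ = gen (scalar (t½ - t⁻½))

  T⁻¹-inverseʳ : ∀ v i → Ring._≈_ (H v) (gen (T i) ⊛ T⁻¹ i) 𝟙
  T⁻¹-inverseʳ v i = H.trans commute (T⁻¹-inverseˡ v i)
    where
    module H = Ring (H v)
    open RingProperties (H v) using (-‿distribˡ-*; -‿distribʳ-*)
    open SetoidReasoning H.setoid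
    τ = gen (T i)
    κ = gen (scalar (t½ - t⁻½))
    commute : τ ⊛ (τ ⊕ ⊖ κ) H.≈ (τ ⊕ ⊖ κ) ⊛ τ
    commute = begin
      τ ⊛ (τ ⊕ ⊖ κ)      ≈⟨ H.distribˡ τ τ (⊖ κ) ⟩
      τ ⊛ τ ⊕ τ ⊛ ⊖ κ    ≈⟨ H.+-congˡ (-‿distribʳ-* τ κ) ⟨
      τ ⊛ τ ⊕ ⊖ (τ ⊛ κ)  ≈⟨ H.+-congˡ (H.-‿cong (Presented.relation (scalar-central _ _))) ⟨
      τ ⊛ τ ⊕ ⊖ (κ ⊛ τ)  ≈⟨ H.+-congˡ (-‿distribˡ-* κ τ) ⟩
      τ ⊛ τ ⊕ ⊖ κ ⊛ τ    ≈⟨ H.distribʳ τ τ (⊖ κ) ⟨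
      (τ ⊕ ⊖ κ) ⊛ τ      ∎

  power : Fin (suc m) → ℤ → Expr Generator
  power i (+ k)    = foldr _⊛_ 𝟙 (List.replicate k (gen (Z i)))
  power i -[1+ k ] = foldr _⊛_ 𝟙 (List.replicate (suc k) (gen (Z⁻¹ i)))

  evaluate : Laurent → Expr Generator
  evaluate = foldr _⊕_ 𝟘 ∘ map λ (a , e) →
    gen (scalar a) ⊛ foldr _⊛_ 𝟙 (map (λ i → power i (lookup e i)) (allFin (suc m)))

  module Localized (v : Side) where

    open Localization (H v) {I = Σ Laurent Nonzero} (evaluate ∘ proj₁) public
      using (ι; inv) renaming (ring to Ĥ; Generator to Generator̂; Relation to Relation̂)

    open Ring Ĥ public
      using () renaming (Carrier to Ĥ-Carrier; _≈_ to _≈̂_; _+_ to _+̂_; _*_ to _*̂_; _-_ to _-̂_)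
    open ListOps Ĥ using (sum; product)

    scalar̂ : Carrier → Ĥ-Carrier
    scalar̂ a = gen (ι (gen (scalar a)))

    T̂ : Fin m → Ĥ-Carrier
    T̂ i = gen (ι (gen (T i)))

    -- The two factors commute, both coming from Laurent polynomials.
    _/_ : Laurent → Σ Laurent Nonzero → Ĥ-Carrier
    f / g = gen (ι (evaluate f)) *̂ gen (inv g)

    numerator denominator : ∀ i j → i ≢ j → Σ Laurent Nonzero
    numerator   i j i≢j = binomial t⁻½ t½ i j , binomial-nonzero t⁻½#0 i≢j
    denominator i j i≢j = binomial 1# 1# i j  , binomial-nonzero 1#0 i≢j

    -- c_ij and its inverse 1/c_ij
    c c⁻¹ : ∀ i j → i ≢ j → Ĥ-Carrier
    c   i j i≢j = proj₁ (numerator i j i≢j) / denominator i j i≢j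
    c⁻¹ i j i≢j = proj₁ (denominator i j i≢j) / numerator i j i≢j

    c*c⁻¹≈1 : ∀ i j i≢j → c i j i≢j *̂ c⁻¹ i j i≢j ≈̂ 𝟙
    c*c⁻¹≈1 i j i≢j = begin
      (N ⊛ D′) ⊛ (D ⊛ N′) ≈⟨ *-assoc N D′ (D ⊛ N′) ⟩
      N ⊛ (D′ ⊛ (D ⊛ N′)) ≈⟨ *-congˡ (*-assoc D′ D N′) ⟨
      N ⊛ ((D′ ⊛ D) ⊛ N′) ≈⟨ *-congˡ (*-congʳ (Presented.relation (Relation̂.invˡ (denominator i j i≢j)))) ⟩
      N ⊛ (𝟙 ⊛ N′)        ≈⟨ *-congˡ (*-identityˡ N′) ⟩
      N ⊛ N′              ≈⟨ Presented.relation (Relation̂.invʳ (numerator i j i≢j)) ⟩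
      𝟙                   ∎
      where
      open Ring Ĥ using (*-assoc; *-congˡ; *-congʳ; *-identityˡ; setoid)
      open SetoidReasoning setoid
      N  = gen (ι (evaluate (proj₁ (numerator i j i≢j))))
      N′ = gen (inv (numerator i j i≢j))
      D  = gen (ι (evaluate (proj₁ (denominator i j i≢j))))
      D′ = gen (inv (denominator i j i≢j))

    ∏[i<j] : (∀ i j → i ≢ j → Ĥ-Carrier) → Ĥ-Carrier
    ∏[i<j] f = product (map (λ i → product (map (factor i) (allFin (suc m)))) (allFin (suc m)))
      where
      factor : ∀ i j → Ĥ-Carrier
      factor i j with i Fin.<? j
      ... | yes i<j = f i j (Fin.<⇒≢ i<j)
      ... | no  _   = 𝟙

    c-w₀ : Ĥ-Carrier
    c-w₀ = ∏[i<j] c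

    -- Replacing each Z by Z⁻¹ turns c_ij into c_ji.
    c-w₀-inverted : Ĥ-Carrier
    c-w₀-inverted = ∏[i<j] λ i j i≢j → c j i (i≢j ∘ sym)

    C : Fin m → Ĥ-Carrier
    C i = T̂ i +̂ scalar̂ t⁻½

    i≢i+1 : ∀ {k} (i : Fin k) → inject₁ i ≢ suc i
    i≢i+1 (suc i) eq = i≢i+1 i (Fin.suc-injective eq)

    i+1≢i : ∀ {k} (i : Fin k) → suc i ≢ inject₁ i
    i+1≢i i = i≢i+1 i ∘ sym

    -- g_w for a family g (T, ξ or η).  These families satisfy the braid relations,
    -- so the choice of reduced word made by reducedWord is immaterial.
    along : (Fin m → Ĥ-Carrier) → Permutation′ (suc m) → Ĥ-Carrier
    along g w = product (map g (ReducedWord.word (reducedWord w)))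

    ∑ : (Permutation′ (suc m) → Ĥ-Carrier) → Ĥ-Carrier
    ∑ f = sum (map f (elements (suc m)))

    -- ℓ(w) - ℓ(w₀)
    ℓ-ℓ₀ : Permutation′ (suc m) → ℤ
    ℓ-ℓ₀ w = + ℓ w ℤ.- + ℓ (w₀ {suc m})

    𝟏₀ ε₀ : Ĥ-Carrier
    𝟏₀ = ∑ λ w → scalar̂ (zpow t½ t⁻½ (ℓ-ℓ₀ w)) *̂ along T̂ w
    ε₀ = ∑ λ w → scalar̂ (zpow (- t⁻½) (- t½) (ℓ-ℓ₀ w)) *̂ along T̂ w

    symmetrizer antisymmetrizer : (Fin m → Ĥ-Carrier) → Ĥ-Carrier
    symmetrizer     g = ∑ (along g)
    antisymmetrizer g = ∑ λ w → scalar̂ (zpow (- 1#) (- 1#) (ℓ-ℓ₀ w)) *̂ along g w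

  module X-side where
    open Localized X public

    ξ : Fin m → Ĥ-Carrier
    ξ i = c⁻¹ (inject₁ i) (suc i) (i≢i+1 i) *̂ (C i -̂ c (suc i) (inject₁ i) (i+1≢i i))

    p₀ e₀ : Ĥ-Carrier
    p₀ = symmetrizer ξ
    e₀ = antisymmetrizer ξ

  module Y-side where
    open Localized Y public

    η : Fin m → Ĥ-Carrier
    η i = c⁻¹ (suc i) (inject₁ i) (i+1≢i i) *̂ (C i -̂ c (inject₁ i) (suc i) (i≢i+1 i))

    p₀ e₀ : Ĥ-Carrier
    p₀ = symmetrizer η
    e₀ = antisymmetrizer η

{-# OPTIONS --safe #-}
-- Put γ_ij = 1/(1 - z_i/z_j), q = t^½ - t^-½ and τ_i = T_i - q γ_{i,i+1}.  The τ_i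
-- permute the z_j, and c_ij = t^½ γ_ji + t^-½ γ_ij.  Both symmetrizers are built
-- from S_{n-1}, acting on the last n-1 indices, through the coset representatives
-- s_{k-1} ⋯ s₀.  If x is a T_i-eigenvector with eigenvalue t^½ for all i ≥ 1, then
--   Σ_k t^{-(m-k)/2} T_{k-1} ⋯ T₀ x = (Σ_k ξ_{k-1} ⋯ ξ₀) (∏_{j>0} c_j0) x,
-- by induction on m after writing T₀ = τ₀ + q γ₀₁; the product over j > 0 is
-- symmetric, so it moves past the symmetrizer of S_{n-1}.
--
-- The Hecke relations depend on t^½ only through q, which is invariant under
-- t^½ ↦ -t^-½.  This turns the formula for 𝟏₀ into one for ε₀ with c_ij replaced
-- by -c_ji, and conjugation by ∏_{i<j} c_ij gives the stated form.  The Y-side is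
-- the X-side for the variables Y_i⁻¹.
module Submission where

open import Defs
open import Algebra.Apartness.Bundles using (HeytingField)
open import Algebra.Bundles using (Ring; Semiring)
open import Data.Bool.Base using (true; false; if_then_else_)
open import Data.Fin.Base as Fin using (Fin; zero; suc; toℕ; inject₁)
import Data.Fin.Properties as Fin
open import Data.Fin.Permutation using (Permutation′; _⟨$⟩ʳ_; insert; remove)
import Data.Fin.Permutation as Perm
open import Data.Integer.Base as ℤ using (+_)
import Data.Integer.Properties as ℤ
open import Data.List.Base using (List; []; _∷_; _++_; [_]; map; concatMap; allFin; tabulate)
open import Data.List.Properties using (map-∘; map-tabulate; map-++)
open import Data.Nat.Base as ℕ using (ℕ; zero; suc; _∸_; z≤n; s≤s; ∣_-_∣)
import Data.Nat.Properties as ℕ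
open import Data.Product.Base using (Σ; _×_; _,_; proj₁)
open import Data.Vec.Base using (lookup; replicate)
import Data.Vec.Properties as Vec
open import Function.Base using (_∘_; id)
open import Function.Bundles using (Injection)
open import Function.Properties.Inverse using (↔⇒↣)
import Level
open import Relation.Binary.Core using (Rel)
open import Relation.Binary.PropositionalEquality as ≡ using (_≡_; _≢_)
open import Relation.Nullary using (¬_; Dec; does; yes; no; contradiction)
import Algebra.Definitions.RawSemiring as Powers
import Algebra.Properties.Ring as RingProperties
import Algebra.Properties.Semiring.Exp as Exp
import Relation.Binary.Reasoning.Setoid as SetoidReasoning

-- Elements of the localized algebra are expressions modulo a generated congruence, so coefficients
-- of the T_w cannot be read off and compared; every identity has to be derived from the relations.
-- Hence the detour through eigenvectors: T_i x = t^½ x is an equation that can be carried along an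
-- induction, with x any element that satisfies it. About the fractions the induction uses only that
-- the γ_ij commute, that γ_ij + γ_ji = 1, and a three-term partial-fraction identity for γ_ij,
-- γ_jk, γ_ik. The last one gives T_i (γ_0i x) a single-term form for consecutive indices, and this
-- makes a sum over cosets collapse to a product. The sums over S_n factor for an arbitrary family
-- g, because the canonical word of w is the word of a coset representative followed by a shifted
-- canonical word. Since ℓ(w) - ℓ(w₀) is never positive, all weights are natural powers of one
-- central element, namely t^-½, -t^½, 1 or -1.

-- Adjacent transpositions acting on points

s-inject₁ : ∀ {m} (i : Fin m) → s i ⟨$⟩ʳ inject₁ i ≡ suc i
s-inject₁ zero    = ≡.refl
s-inject₁ (suc i) = ≡.trans (s-suc i (inject₁ i)) (≡.cong suc (s-inject₁ i))

s-suc≡inject₁ : ∀ {m} (i : Fin m) → s i ⟨$⟩ʳ suc i ≡ inject₁ i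
s-suc≡inject₁ zero    = ≡.refl
s-suc≡inject₁ (suc i) = ≡.trans (s-suc i (suc i)) (≡.cong suc (s-suc≡inject₁ i))

s-below : ∀ {m} (i : Fin m) k → toℕ k ℕ.< toℕ i → s i ⟨$⟩ʳ k ≡ k
s-below (suc i) zero    _         = ≡.refl
s-below (suc i) (suc k) (s≤s k<i) = ≡.trans (s-suc i k) (≡.cong suc (s-below i k k<i))

s-other : ∀ {m} (i : Fin m) j → j ≢ inject₁ i → j ≢ suc i → s i ⟨$⟩ʳ j ≡ j
s-other zero    zero          j≢i _     = contradiction ≡.refl j≢i
s-other zero    (suc zero)    _   j≢i+1 = contradiction ≡.refl j≢i+1
s-other zero    (suc (suc j)) _   _     = ≡.refl
s-other (suc i) zero          _   _     = ≡.refl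
s-other (suc i) (suc j)       j≢i j≢i+1 =
  ≡.trans (s-suc i j) (≡.cong suc (s-other i j (j≢i ∘ ≡.cong suc) (j≢i+1 ∘ ≡.cong suc)))

inject₁≢suc : ∀ {m} (i : Fin m) → inject₁ i ≢ suc i
inject₁≢suc (suc i) eq = inject₁≢suc i (Fin.suc-injective eq)

-- Intertwining relations, products and sums in a noncommutative ring

module RingProducts {a ℓ} (A : Ring a ℓ) where

  open Ring A hiding (zero)
  open ListOps A public using (sum; product)
  open Exp semiring public using (_^_; ^-homo-*; ^-congˡ)
  open SetoidReasoning setoid

  Central : Carrier → Set _
  Central z = ∀ x → z * x ≈ x * z

  1-central : Central 1#
  1-central x = trans (*-identityˡ x) (sym (*-identityʳ x))

  central-swap : ∀ {z} → Central z → ∀ x y → x * (z * y) ≈ z * (x * y)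
  central-swap {z} z-central x y = begin
    x * (z * y)  ≈⟨ *-assoc x z y ⟨
    x * z * y    ≈⟨ *-congʳ (z-central x) ⟨
    z * x * y    ≈⟨ *-assoc z x y ⟩
    z * (x * y)  ∎

  -- t intertwines x with y when t x = y t; commutation is the case x = y.
  intertwines-* : ∀ {t x x′ y y′} → t * x ≈ y * t → t * x′ ≈ y′ * t →
                  t * (x * x′) ≈ (y * y′) * t
  intertwines-* {t} {x} {x′} {y} {y′} tx≈yt tx′≈y′t = begin
    t * (x * x′)  ≈⟨ *-assoc t x x′ ⟨
    t * x * x′    ≈⟨ *-congʳ tx≈yt ⟩
    y * t * x′    ≈⟨ *-assoc y t x′ ⟩
    y * (t * x′)  ≈⟨ *-congˡ tx′≈y′t ⟩
    y * (y′ * t)  ≈⟨ *-assoc y y′ t ⟨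
    y * y′ * t    ∎

  intertwines-*ˡ : ∀ {t t′ x y z} → t * y ≈ z * t → t′ * x ≈ y * t′ →
                   (t * t′) * x ≈ z * (t * t′)
  intertwines-*ˡ {t} {t′} {x} {y} {z} ty≈zt t′x≈yt′ = begin
    t * t′ * x    ≈⟨ *-assoc t t′ x ⟩
    t * (t′ * x)  ≈⟨ *-congˡ t′x≈yt′ ⟩
    t * (y * t′)  ≈⟨ *-assoc t y t′ ⟨
    t * y * t′    ≈⟨ *-congʳ ty≈zt ⟩
    z * t * t′    ≈⟨ *-assoc z t t′ ⟩
    z * (t * t′)  ∎

  intertwines-+ : ∀ {t x x′ y y′} → t * x ≈ y * t → t * x′ ≈ y′ * t →
                  t * (x + x′) ≈ (y + y′) * t
  intertwines-+ {t} {x} {x′} {y} {y′} tx≈yt tx′≈y′t =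
    trans (distribˡ t x x′) (trans (+-cong tx≈yt tx′≈y′t) (sym (distribʳ t y y′)))

  intertwines-inverse : ∀ {t x y x⁻¹ y⁻¹} → x * x⁻¹ ≈ 1# → y⁻¹ * y ≈ 1# →
                        t * x ≈ y * t → t * x⁻¹ ≈ y⁻¹ * t
  intertwines-inverse {t} {x} {y} {x⁻¹} {y⁻¹} xx⁻¹≈1 y⁻¹y≈1 tx≈yt = begin
    t * x⁻¹                ≈⟨ *-identityˡ _ ⟨
    1# * (t * x⁻¹)         ≈⟨ *-congʳ y⁻¹y≈1 ⟨
    y⁻¹ * y * (t * x⁻¹)    ≈⟨ *-assoc y⁻¹ y _ ⟩
    y⁻¹ * (y * (t * x⁻¹))  ≈⟨ *-congˡ (*-assoc y t x⁻¹) ⟨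
    y⁻¹ * (y * t * x⁻¹)    ≈⟨ *-congˡ (*-congʳ tx≈yt) ⟨
    y⁻¹ * (t * x * x⁻¹)    ≈⟨ *-congˡ (*-assoc t x x⁻¹) ⟩
    y⁻¹ * (t * (x * x⁻¹))  ≈⟨ *-congˡ (*-congˡ xx⁻¹≈1) ⟩
    y⁻¹ * (t * 1#)         ≈⟨ *-congˡ (*-identityʳ t) ⟩
    y⁻¹ * t                ∎

  -- The element t y⁻¹ t is a left inverse of z. This turns the relation between Y_i and Y_{i+1}
  -- into the relation that the X_i satisfy, for the variables Y_i⁻¹.
  conjugate-inverse : ∀ {t t⁻¹ y y⁻¹ z z⁻¹} → t * t⁻¹ ≈ 1# → y⁻¹ * y ≈ 1# → z * z⁻¹ ≈ 1# →
                      z ≈ t⁻¹ * y * t⁻¹ → t * y⁻¹ * t ≈ z⁻¹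
  conjugate-inverse {t} {t⁻¹} {y} {y⁻¹} {z} {z⁻¹} tt⁻¹≈1 y⁻¹y≈1 zz⁻¹≈1 z≈t⁻¹yt⁻¹ = begin
    t * y⁻¹ * t                ≈⟨ *-identityʳ _ ⟨
    t * y⁻¹ * t * 1#           ≈⟨ *-congˡ zz⁻¹≈1 ⟨
    t * y⁻¹ * t * (z * z⁻¹)    ≈⟨ *-assoc _ z z⁻¹ ⟨
    t * y⁻¹ * t * z * z⁻¹      ≈⟨ *-congʳ cancels ⟩
    1# * z⁻¹                   ≈⟨ *-identityˡ _ ⟩
    z⁻¹                        ∎
    where
    cancels : t * y⁻¹ * t * z ≈ 1#
    cancels = begin
      t * y⁻¹ * t * z                     ≈⟨ *-congˡ z≈t⁻¹yt⁻¹ ⟩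
      t * y⁻¹ * t * (t⁻¹ * y * t⁻¹)       ≈⟨ *-assoc _ t _ ⟩
      t * y⁻¹ * (t * (t⁻¹ * y * t⁻¹))
        ≈⟨ *-congˡ (trans (*-congˡ (*-assoc t⁻¹ y t⁻¹)) (sym (*-assoc t t⁻¹ _))) ⟩
      t * y⁻¹ * (t * t⁻¹ * (y * t⁻¹))     ≈⟨ *-congˡ (trans (*-congʳ tt⁻¹≈1) (*-identityˡ _)) ⟩
      t * y⁻¹ * (y * t⁻¹)                 ≈⟨ trans (*-assoc t y⁻¹ _) (*-congˡ (sym (*-assoc y⁻¹ y t⁻¹))) ⟩
      t * (y⁻¹ * y * t⁻¹)                 ≈⟨ *-congˡ (trans (*-congʳ y⁻¹y≈1) (*-identityˡ _)) ⟩
      t * t⁻¹                             ≈⟨ tt⁻¹≈1 ⟩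
      1#                                  ∎

  ^-central : ∀ {z} → Central z → ∀ n → Central (z ^ n)
  ^-central z-central zero    x = 1-central x
  ^-central z-central (suc n) x =
    sym (intertwines-* (sym (z-central x)) (sym (^-central z-central n x)))

  1^n≈1 : ∀ n → 1# ^ n ≈ 1#
  1^n≈1 zero    = refl
  1^n≈1 (suc n) = trans (*-identityˡ _) (1^n≈1 n)

  infix 10 ∏_

  ∏_ : ∀ {n} → (Fin n → Carrier) → Carrier
  ∏ f = product (tabulate f)

  ∏-cong : ∀ {n} {f g : Fin n → Carrier} → (∀ i → f i ≈ g i) → ∏ f ≈ ∏ g
  ∏-cong {zero}  f≈g = refl
  ∏-cong {suc n} f≈g = *-cong (f≈g zero) (∏-cong (f≈g ∘ suc))

  ∏-allFin : ∀ {n} (f : Fin n → Carrier) → product (map f (allFin n)) ≈ ∏ f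
  ∏-allFin f = reflexive (≡.cong product (map-tabulate id f))

  ∏-scale : ∀ {z} → Central z → ∀ {n} (f : Fin n → Carrier) → ∏ (λ i → z * f i) ≈ z ^ n * ∏ f
  ∏-scale z-central {zero}  f = sym (*-identityˡ 1#)
  ∏-scale {z} z-central {suc n} f = begin
    z * f zero * ∏ (λ i → z * f (suc i))   ≈⟨ *-congˡ (∏-scale z-central (f ∘ suc)) ⟩
    z * f zero * (z ^ n * ∏ (f ∘ suc))     ≈⟨ *-assoc z _ _ ⟩
    z * (f zero * (z ^ n * ∏ (f ∘ suc)))   ≈⟨ *-congˡ (central-swap (^-central z-central n) _ _) ⟩
    z * (z ^ n * (f zero * ∏ (f ∘ suc)))   ≈⟨ *-assoc z _ _ ⟨
    z ^ suc n * ∏ f                        ∎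

  intertwines-∏ : ∀ {t n} {f g : Fin n → Carrier} → (∀ i → t * f i ≈ g i * t) →
                  t * ∏ f ≈ ∏ g * t
  intertwines-∏ {n = zero}  tf≈gt = sym (1-central _)
  intertwines-∏ {n = suc n} tf≈gt = intertwines-* (tf≈gt zero) (intertwines-∏ (tf≈gt ∘ suc))

  -- Two adjacent factors are exchanged, which the commuting product does not see.
  swap-∏ : ∀ {t m} {f : Fin (suc m) → Carrier} (i : Fin m) →
           f (inject₁ i) * f (suc i) ≈ f (suc i) * f (inject₁ i) →
           (∀ j → t * f j ≈ f (s i ⟨$⟩ʳ j) * t) → t * ∏ f ≈ ∏ f * t
  swap-∏ {t} {f = f} zero f-comm tf≈ft = begin
    t * (f zero * (f (suc zero) * R))  ≈⟨ *-congˡ (*-assoc _ _ R) ⟨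
    t * (f zero * f (suc zero) * R)    ≈⟨ intertwines-* (intertwines-* (tf≈ft zero) (tf≈ft (suc zero)))
                                            (intertwines-∏ (λ j → tf≈ft (suc (suc j)))) ⟩
    f (suc zero) * f zero * R * t      ≈⟨ *-congʳ (*-congʳ f-comm) ⟨
    f zero * f (suc zero) * R * t      ≈⟨ *-congʳ (*-assoc _ _ R) ⟩
    f zero * (f (suc zero) * R) * t    ∎
    where R = ∏ (λ j → f (suc (suc j)))
  swap-∏ {t} {f = f} (suc i) f-comm tf≈ft = intertwines-* (tf≈ft zero)
    (swap-∏ {f = f ∘ suc} i f-comm λ j →
      trans (tf≈ft (suc j)) (*-congʳ (reflexive (≡.cong f (s-suc i j)))))

  -- Peeling off the row of index 0 matches the passage from S_n to S_{n-1}; the product in the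
  -- theorem instead runs over all pairs, with 1 where i ≥ j.
  ∏< : ∀ {n} → (Fin n → Fin n → Carrier) → Carrier
  ∏< {zero}  f = 1#
  ∏< {suc n} f = ∏ (λ j → f zero (suc j)) * ∏< (λ i j → f (suc i) (suc j))

  ∏∏≈∏< : ∀ {n} {f g : Fin n → Fin n → Carrier} → (∀ i j → i Fin.< j → f i j ≈ g i j) →
           (∀ i j → ¬ (i Fin.< j) → f i j ≈ 1#) → ∏ (λ i → ∏ (f i)) ≈ ∏< g
  ∏∏≈∏< {zero}  f≈g f≈1 = refl
  ∏∏≈∏< {suc n} {f} {g} f≈g f≈1 = *-cong
    (trans (*-cong (f≈1 zero zero λ ()) (∏-cong (λ j → f≈g zero (suc j) (s≤s z≤n)))) (*-identityˡ _))
    (trans (∏-cong (λ i → trans (*-congʳ (f≈1 (suc i) zero λ ())) (*-identityˡ _)))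
      (∏∏≈∏< (λ i j i<j → f≈g (suc i) (suc j) (s≤s i<j)) (λ i j i≮j → f≈1 (suc i) (suc j) (i≮j ∘ ℕ.s<s⁻¹))))

  sum-cong : ∀ {ℓ′} {B : Set ℓ′} {f g : B → Carrier} → (∀ x → f x ≈ g x) →
             ∀ xs → sum (map f xs) ≈ sum (map g xs)
  sum-cong f≈g []       = refl
  sum-cong f≈g (x ∷ xs) = +-cong (f≈g x) (sum-cong f≈g xs)

  sum-++ : ∀ xs ys → sum (xs ++ ys) ≈ sum xs + sum ys
  sum-++ []       ys = sym (+-identityˡ _)
  sum-++ (x ∷ xs) ys = trans (+-congˡ (sum-++ xs ys)) (sym (+-assoc x _ _))

  product-++ : ∀ xs ys → product (xs ++ ys) ≈ product xs * product ys
  product-++ []       ys = sym (*-identityˡ _)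
  product-++ (x ∷ xs) ys = trans (*-congˡ (product-++ xs ys)) (sym (*-assoc x _ _))

  sum-concatMap : ∀ {ℓ₁ ℓ₂} {B : Set ℓ₁} {D : Set ℓ₂} (f : D → Carrier) (g : B → List D) xs →
                  sum (map f (concatMap g xs)) ≈ sum (map (λ x → sum (map f (g x))) xs)
  sum-concatMap f g []       = refl
  sum-concatMap f g (x ∷ xs) = begin
    sum (map f (g x ++ concatMap g xs))                ≡⟨ ≡.cong sum (map-++ f (g x) _) ⟩
    sum (map f (g x) ++ map f (concatMap g xs))        ≈⟨ sum-++ (map f (g x)) _ ⟩
    sum (map f (g x)) + sum (map f (concatMap g xs))   ≈⟨ +-congˡ (sum-concatMap f g xs) ⟩
    sum (map f (g x)) + sum (map (λ x → sum (map f (g x))) xs) ∎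

  sum-*ˡ : ∀ {ℓ′} {B : Set ℓ′} z (f : B → Carrier) xs → sum (map (λ x → z * f x) xs) ≈ z * sum (map f xs)
  sum-*ˡ z f []       = sym (zeroʳ z)
  sum-*ˡ z f (x ∷ xs) = trans (+-congˡ (sum-*ˡ z f xs)) (sym (distribˡ z _ _))

  sum-*ʳ : ∀ {ℓ′} {B : Set ℓ′} z (f : B → Carrier) xs → sum (map (λ x → f x * z) xs) ≈ sum (map f xs) * z
  sum-*ʳ z f []       = sym (zeroˡ z)
  sum-*ʳ z f (x ∷ xs) = trans (+-congˡ (sum-*ʳ z f xs)) (sym (distribʳ z _ _))

-- Length-weighted sums over the symmetric group

module WeightedSums {a ℓ} (A : Ring a ℓ) where

  open Ring A hiding (zero)
  open RingProducts A
  open SetoidReasoning setoid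

  along : ∀ {m} → (Fin m → Carrier) → Permutation′ (suc m) → Carrier
  along g w = product (map g (canonicalWord w))

  -- One shape for all four sums: β is t^-½ for `𝟏₀`, -t^½ for `ε₀`, 1 for `p₀` and -1 for `e₀`. The
  -- truncated subtraction is exact by `w₀-longest`.
  weighted : ∀ {m} → Carrier → (Fin m → Carrier) → Carrier
  weighted {m} β g = sum (map (λ w → β ^ (len (w₀ {suc m}) ∸ len w) * along g w) (elements (suc m)))

  -- The sum of β^{m-k} g_{k-1} ⋯ g₀ over the coset representatives s_{k-1} ⋯ s₀,
  -- in the form of Horner's scheme.
  coset : ∀ {m} → Carrier → (Fin m → Carrier) → Carrier
  coset {zero}  β g = 1#
  coset {suc m} β g = β ^ suc m + coset β (g ∘ suc) * g zero

  -- The word `descent (suc k)` ends in the letter 0, so all terms except that of k = 0 share the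
  -- right factor `g zero`, and what precedes it is the same sum for the shifted family.
  coset≈sum : ∀ {m} β (g : Fin m → Carrier) →
              coset β g ≈ sum (map (λ k → β ^ (m ∸ toℕ k) * product (map g (descent k))) (allFin (suc m)))
  coset≈sum {zero}  β g = sym (trans (+-identityʳ _) (*-identityˡ 1#))
  coset≈sum {suc m} β g = +-cong (sym (*-identityʳ _)) (begin
    coset β (g ∘ suc) * g zero                      ≈⟨ *-congʳ (coset≈sum β (g ∘ suc)) ⟩
    sum (map term′ (allFin (suc m))) * g zero       ≈⟨ sum-*ʳ (g zero) term′ (allFin (suc m)) ⟨
    sum (map (λ k → term′ k * g zero) (allFin (suc m)))  ≈⟨ sum-cong step (allFin (suc m)) ⟩
    sum (map (term ∘ suc) (allFin (suc m)))         ≡⟨ ≡.cong sum (map-tabulate id (term ∘ suc)) ⟩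
    sum (tabulate (term ∘ suc))                     ≡⟨ ≡.cong sum (map-tabulate suc term) ⟨
    sum (map term (tabulate suc))                   ∎)
    where
    term : Fin (suc (suc m)) → Carrier
    term k = β ^ (suc m ∸ toℕ k) * product (map g (descent k))
    term′ : Fin (suc m) → Carrier
    term′ k = β ^ (m ∸ toℕ k) * product (map (g ∘ suc) (descent k))
    step : ∀ k → term′ k * g zero ≈ term (suc k)
    step k = trans (*-assoc _ _ _) (*-congˡ (sym (begin
      product (map g (map suc (descent k) ++ [ zero ]))  ≡⟨ ≡.cong product (map-++ g (map suc (descent k)) [ zero ]) ⟩
      product (map g (map suc (descent k)) ++ [ g zero ]) ≈⟨ product-++ (map g (map suc (descent k))) [ g zero ] ⟩
      product (map g (map suc (descent k))) * (g zero * 1#)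
        ≈⟨ *-cong (reflexive (≡.cong product (≡.sym (map-∘ (descent k))))) (*-identityʳ _) ⟩
      product (map (g ∘ suc) (descent k)) * g zero        ∎)))


  len-insert : ∀ {m} k (v : Permutation′ (suc m)) → len (insert zero k v) ≡ toℕ k ℕ.+ len v
  len-insert k v = ≡.trans (len-step (insert zero k v))
    (≡.cong (toℕ k ℕ.+_) (len-cong {v = remove zero (insert zero k v)} {v} (Perm.remove-insert zero k v)))

  -- Maximality is applied twice: to what remains of the larger `w₀` after removing 0, and to the
  -- extension of the smaller `w₀` that sends 0 to the last point.
  len-w₀ : ∀ m → len (w₀ {suc (suc m)}) ≡ suc m ℕ.+ len (w₀ {suc m})
  len-w₀ m = ℕ.≤-antisym
    (≡.subst (ℕ._≤ suc m ℕ.+ len (w₀ {suc m})) (≡.sym (len-step (w₀ {suc (suc m)})))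
      (ℕ.+-mono-≤ (Fin.toℕ≤pred[n] (w₀ {suc (suc m)} ⟨$⟩ʳ zero)) (w₀-longest (remove zero (w₀ {suc (suc m)})))))
    (≡.subst (ℕ._≤ len (w₀ {suc (suc m)}))
      (≡.trans (len-insert (Fin.fromℕ (suc m)) w₀) (≡.cong (ℕ._+ len (w₀ {suc m})) (Fin.toℕ-fromℕ (suc m))))
      (w₀-longest (insert zero (Fin.fromℕ (suc m)) w₀)))

  along-insert : ∀ {m} (g : Fin (suc m) → Carrier) k v →
                 along g (insert zero k v) ≈ product (map g (descent k)) * along (g ∘ suc) v
  along-insert g k v = begin
    product (map g (descent k ++ map suc (canonicalWord (remove zero (insert zero k v)))))
      ≡⟨ ≡.cong (λ u → product (map g (descent k ++ map suc u)))
           (canonicalWord-cong {v = remove zero (insert zero k v)} {v} (Perm.remove-insert zero k v)) ⟩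
    product (map g (descent k ++ map suc (canonicalWord v)))
      ≡⟨ ≡.cong product (map-++ g (descent k) _) ⟩
    product (map g (descent k) ++ map g (map suc (canonicalWord v)))
      ≈⟨ product-++ (map g (descent k)) _ ⟩
    product (map g (descent k)) * product (map g (map suc (canonicalWord v)))
      ≡⟨ ≡.cong (λ u → product (map g (descent k)) * product u) (map-∘ (canonicalWord v)) ⟨
    product (map g (descent k)) * along (g ∘ suc) v  ∎

  weighted-zero : ∀ β (g : Fin 0 → Carrier) → weighted β g ≈ 1#
  weighted-zero β g = trans (+-identityʳ _) (*-identityˡ 1#)

  -- Lengths add under `insert zero k v`, so the exponent splits as (suc m - k) + (N′ - len v), and
  -- centrality of β lets the second power pass the coset representative. As g is arbitrary, this
  -- serves the sums over T_w and over ξ_w alike.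
  weighted-suc : ∀ {m} {β} → Central β → (g : Fin (suc m) → Carrier) →
                 weighted β g ≈ coset β g * weighted β (g ∘ suc)
  weighted-suc {m} {β} β-central g = begin
    weighted β g
      ≈⟨ sum-concatMap term (λ k → map (insert zero k) (elements (suc m))) (allFin (suc (suc m))) ⟩
    sum (map (λ k → sum (map term (map (insert zero k) (elements (suc m))))) (allFin (suc (suc m))))
      ≈⟨ sum-cong factored (allFin (suc (suc m))) ⟩
    sum (map (λ k → rep k * weighted β (g ∘ suc)) (allFin (suc (suc m))))
      ≈⟨ sum-*ʳ (weighted β (g ∘ suc)) rep (allFin (suc (suc m))) ⟩
    sum (map rep (allFin (suc (suc m)))) * weighted β (g ∘ suc)
      ≈⟨ *-congʳ (coset≈sum β g) ⟨
    coset β g * weighted β (g ∘ suc)  ∎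
    where
    N N′ : ℕ
    N  = len (w₀ {suc (suc m)})
    N′ = len (w₀ {suc m})
    term : Permutation′ (suc (suc m)) → Carrier
    term w = β ^ (N ∸ len w) * along g w
    term′ : Permutation′ (suc m) → Carrier
    term′ v = β ^ (N′ ∸ len v) * along (g ∘ suc) v
    rep : Fin (suc (suc m)) → Carrier
    rep k = β ^ (suc m ∸ toℕ k) * product (map g (descent k))

    exponent : ∀ k v → N ∸ len (insert zero k v) ≡ (suc m ∸ toℕ k) ℕ.+ (N′ ∸ len v)
    exponent k v = ≡.trans (≡.cong₂ _∸_ (len-w₀ m) (len-insert k v))
      (≡.trans (≡.sym (ℕ.∸-+-assoc (suc m ℕ.+ N′) (toℕ k) (len v)))
      (≡.trans (≡.cong (_∸ len v) (ℕ.+-∸-comm N′ (Fin.toℕ≤pred[n] k)))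
               (ℕ.+-∸-assoc (suc m ∸ toℕ k) (w₀-longest v))))

    split : ∀ k v → term (insert zero k v) ≈ rep k * term′ v
    split k v = begin
      β ^ (N ∸ len (insert zero k v)) * along g (insert zero k v)
        ≈⟨ *-cong (reflexive (≡.cong (β ^_) (exponent k v))) (along-insert g k v) ⟩
      β ^ (K ℕ.+ L) * (P * Q)        ≈⟨ *-congʳ (^-homo-* β K L) ⟩
      β ^ K * β ^ L * (P * Q)        ≈⟨ *-assoc _ _ _ ⟩
      β ^ K * (β ^ L * (P * Q))      ≈⟨ *-congˡ (central-swap (^-central β-central L) P Q) ⟨
      β ^ K * (P * (β ^ L * Q))      ≈⟨ *-assoc _ _ _ ⟨
      rep k * term′ v                ∎
      where
      K = suc m ∸ toℕ k
      L = N′ ∸ len v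
      P = product (map g (descent k))
      Q = along (g ∘ suc) v

    factored : ∀ k → sum (map term (map (insert zero k) (elements (suc m)))) ≈ rep k * weighted β (g ∘ suc)
    factored k = begin
      sum (map term (map (insert zero k) (elements (suc m))))  ≡⟨ ≡.cong sum (map-∘ (elements (suc m))) ⟨
      sum (map (term ∘ insert zero k) (elements (suc m)))      ≈⟨ sum-cong (split k) (elements (suc m)) ⟩
      sum (map (λ v → rep k * term′ v) (elements (suc m)))     ≈⟨ sum-*ˡ (rep k) term′ (elements (suc m)) ⟩
      rep k * weighted β (g ∘ suc)                             ∎

  intertwines-coset : ∀ {m β} → Central β → {g h : Fin m → Carrier} → ∀ {x} →
                      (∀ i → g i * x ≈ x * h i) → coset β g * x ≈ x * coset β h
  intertwines-coset {zero}  β-central gx≈xh = 1-central _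
  intertwines-coset {suc m} β-central gx≈xh = sym (intertwines-+
    (sym (^-central β-central (suc m) _))
    (intertwines-* (sym (intertwines-coset β-central (gx≈xh ∘ suc))) (sym (gx≈xh zero))))

  -- Needed with g = h, to move a symmetric product past a symmetrizer, and with x the full product
  -- of the c_ij, to exchange two normalizations of the intertwiners.
  intertwines-weighted : ∀ {m β} → Central β → {g h : Fin m → Carrier} → ∀ {x} →
                         (∀ i → g i * x ≈ x * h i) → weighted β g * x ≈ x * weighted β h
  intertwines-weighted {zero} {β} β-central {g} {h} {x} gx≈xh = begin
    weighted β g * x  ≈⟨ *-congʳ (weighted-zero β g) ⟩
    1# * x            ≈⟨ 1-central x ⟩
    x * 1#            ≈⟨ *-congˡ (weighted-zero β h) ⟨
    x * weighted β h  ∎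
  intertwines-weighted {suc m} {β} β-central {g} {h} {x} gx≈xh = begin
    weighted β g * x
      ≈⟨ *-congʳ (weighted-suc β-central g) ⟩
    coset β g * weighted β (g ∘ suc) * x
      ≈⟨ intertwines-* (sym (intertwines-coset β-central gx≈xh)) (sym (intertwines-weighted β-central (gx≈xh ∘ suc))) ⟨
    x * (coset β h * weighted β (h ∘ suc))
      ≈⟨ *-congˡ (weighted-suc β-central h) ⟨
    x * weighted β h  ∎

-- Hecke families, eigenvectors and the factorization of the symmetrizer

module HeckeFamilies {e ℓ} (A : Ring e ℓ)
  (q : Ring.Carrier A) (q-central : RingProducts.Central A q) where

  open Ring A hiding (zero)
  open RingProducts A
  open WeightedSums A
  open RingProperties A using (+-cancelʳ; -‿distribˡ-*; -‿distribʳ-*; -‿involutive; -‿+-comm; -1*x≈-x)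
  open SetoidReasoning setoid

  -- γ i j plays the role of 1/(1 - z_i/z_j).  The elements T_i - q γ_{i,i+1} are
  -- the unnormalized intertwiners.
  record HeckeFamily {m} (T : Fin m → Carrier) (γ : Fin (suc m) → Fin (suc m) → Carrier) : Set (e Level.⊔ ℓ) where
    τ : Fin m → Carrier
    τ i = T i - q * γ (inject₁ i) (suc i)
    field
      braid       : ∀ i j → toℕ j ≡ suc (toℕ i) → T i * T j * T i ≈ T j * T i * T j
      far         : ∀ i j → 1 ℕ.< ∣ toℕ i - toℕ j ∣ → T i * T j ≈ T j * T i
      quadratic   : ∀ i → T i * T i ≈ q * T i + 1#
      γ-comm      : ∀ i j k l → γ i j * γ k l ≈ γ k l * γ i j
      γ-sum       : ∀ i j → i ≢ j → γ i j + γ j i ≈ 1#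
      γ-cocycle   : ∀ i j k → i ≢ j → j ≢ k → i ≢ k →
                    γ i k + γ i j * γ j k ≈ γ i j * γ i k + γ i k * γ j k
      intertwines : ∀ i j k → τ i * γ j k ≈ γ (s i ⟨$⟩ʳ j) (s i ⟨$⟩ʳ k) * τ i

    T≈τ+qγ : ∀ i → T i ≈ τ i + q * γ (inject₁ i) (suc i)
    T≈τ+qγ i = begin
      T i                                     ≈⟨ +-identityʳ _ ⟨
      T i + 0#                                ≈⟨ +-congˡ (-‿inverseˡ _) ⟨
      T i + (- (q * _) + q * _)               ≈⟨ +-assoc _ _ _ ⟨
      τ i + q * γ (inject₁ i) (suc i)         ∎

    intertwines-T : ∀ i j k → s i ⟨$⟩ʳ j ≡ j → s i ⟨$⟩ʳ k ≡ k → T i * γ j k ≈ γ j k * T i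
    intertwines-T i j k sj≡j sk≡k = begin
      T i * γ j k                                  ≈⟨ *-congʳ (T≈τ+qγ i) ⟩
      (τ i + q * γ (inject₁ i) (suc i)) * γ j k    ≈⟨ intertwines-+ (sym τγ≈γτ)
                                                        (intertwines-* (sym (q-central _)) (γ-comm j k _ _)) ⟨
      γ j k * (τ i + q * γ (inject₁ i) (suc i))    ≈⟨ *-congˡ (T≈τ+qγ i) ⟨
      γ j k * T i                                  ∎
      where
      τγ≈γτ : τ i * γ j k ≈ γ j k * τ i
      τγ≈γτ = trans (intertwines i j k) (*-congʳ (reflexive (≡.cong₂ γ sj≡j sk≡k)))

  restrict : ∀ {m T γ} → HeckeFamily {suc m} T γ → HeckeFamily (T ∘ suc) (λ i j → γ (suc i) (suc j))
  restrict {γ = γ} F = record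
    { braid       = λ i j eq → F.braid (suc i) (suc j) (≡.cong suc eq)
    ; far         = λ i j → F.far (suc i) (suc j)
    ; quadratic   = λ i → F.quadratic (suc i)
    ; γ-comm      = λ i j k l → F.γ-comm (suc i) (suc j) (suc k) (suc l)
    ; γ-sum       = λ i j i≢j → F.γ-sum (suc i) (suc j) (i≢j ∘ Fin.suc-injective)
    ; γ-cocycle   = λ i j k i≢j j≢k i≢k → F.γ-cocycle (suc i) (suc j) (suc k)
                      (i≢j ∘ Fin.suc-injective) (j≢k ∘ Fin.suc-injective) (i≢k ∘ Fin.suc-injective)
    ; intertwines = λ i j k → trans (F.intertwines (suc i) (suc j) (suc k))
                      (*-congʳ (reflexive (≡.cong₂ γ (s-suc i j) (s-suc i k))))
    }
    where module F = HeckeFamily F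

  module Eigenvalues (a b : Carrier) (a-central : Central a) (b-central : Central b)
    (a≈b+q : a ≈ b + q) (ab≈1 : a * b ≈ 1#) where

    -- These letters generate the parabolic subalgebra of S_{n-1}, the stabilizer of the point 0.
    -- The condition is stable under the inductions below, which replace x by `T zero * x` or
    -- `τ₀ * x` and shift the family.
    InvariantAbove₀ : ∀ {m} → (Fin m → Carrier) → Carrier → Set ℓ
    InvariantAbove₀ T x = ∀ i → 0 ℕ.< toℕ i → T i * x ≈ a * x

    -- The quadratic relation factors as (t - a)(t + b) = 0.
    rank-one : ∀ {t} → t * t ≈ q * t + 1# → t * (b + t) ≈ a * (b + t)
    rank-one {t} tt≈qt+1 = begin
      t * (b + t)             ≈⟨ distribˡ t b t ⟩
      t * b + t * t           ≈⟨ +-cong (b-central t) (sym tt≈qt+1) ⟨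
      b * t + (q * t + 1#)    ≈⟨ +-assoc _ _ _ ⟨
      b * t + q * t + 1#      ≈⟨ +-cong (distribʳ t b q) ab≈1 ⟨
      (b + q) * t + a * b     ≈⟨ +-congʳ (*-congʳ a≈b+q) ⟨
      a * t + a * b           ≈⟨ +-comm _ _ ⟩
      a * b + a * t           ≈⟨ distribˡ a b t ⟨
      a * (b + t)             ∎

    -- For a letter above 0, Horner's scheme reduces to `T zero * x`, which is still an eigenvector
    -- for the letters from 2 on because they commute with `T zero`. With x the symmetrizer of
    -- S_{n-1} this makes the symmetrizer of S_n an eigenvector.
    coset-eigen : ∀ {m} {T : Fin m → Carrier} {γ} → HeckeFamily T γ → ∀ {x} → InvariantAbove₀ T x →
                  ∀ i → T i * (coset b T * x) ≈ a * (coset b T * x)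
    coset-eigen {suc m} {T} F {x} Tx≈ax (suc i) = begin
      T (suc i) * (coset b T * x)                ≈⟨ *-congˡ expand ⟩
      T (suc i) * (B * x + S * (T zero * x))     ≈⟨ distribˡ _ _ _ ⟩
      T (suc i) * (B * x) + T (suc i) * (S * (T zero * x))
        ≈⟨ +-cong (trans (central-swap B-central _ x) (trans (*-congˡ (Tx≈ax (suc i) (s≤s z≤n))) (central-swap a-central B x)))
                  (coset-eigen (restrict F) T₀x-invariant i) ⟩
      a * (B * x) + a * (S * (T zero * x))       ≈⟨ distribˡ a _ _ ⟨
      a * (B * x + S * (T zero * x))             ≈⟨ *-congˡ expand ⟨
      a * (coset b T * x)                        ∎
      where
      open HeckeFamily F
      B = b ^ suc m
      B-central = ^-central b-central (suc m)
      S = coset b (T ∘ suc)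
      expand : coset b T * x ≈ B * x + S * (T zero * x)
      expand = trans (distribʳ x B _) (+-congˡ (*-assoc S _ x))
      T₀x-invariant : InvariantAbove₀ (T ∘ suc) (T zero * x)
      T₀x-invariant (suc j) _ = begin
        T (suc (suc j)) * (T zero * x)   ≈⟨ *-assoc _ _ _ ⟨
        T (suc (suc j)) * T zero * x     ≈⟨ *-congʳ (far (suc (suc j)) zero (s≤s (s≤s z≤n))) ⟩
        T zero * T (suc (suc j)) * x     ≈⟨ *-assoc _ _ _ ⟩
        T zero * (T (suc (suc j)) * x)   ≈⟨ *-congˡ (Tx≈ax (suc (suc j)) (s≤s z≤n)) ⟩
        T zero * (a * x)                 ≈⟨ central-swap a-central _ x ⟩
        a * (T zero * x)                 ∎
    coset-eigen {suc zero} {T} F {x} Tx≈ax zero = begin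
      T zero * (coset b T * x)         ≈⟨ *-assoc _ _ x ⟨
      T zero * coset b T * x           ≈⟨ *-congʳ (*-congˡ coset≈) ⟩
      T zero * (b + T zero) * x        ≈⟨ *-congʳ (rank-one (HeckeFamily.quadratic F zero)) ⟩
      a * (b + T zero) * x             ≈⟨ *-congʳ (*-congˡ coset≈) ⟨
      a * coset b T * x                ≈⟨ *-assoc _ _ x ⟩
      a * (coset b T * x)              ∎
      where
      coset≈ : coset b T ≈ b + T zero
      coset≈ = +-cong (*-identityʳ b) (*-identityˡ _)
    -- Two Horner levels are unfolded. On (b + T₀) x the eigenvalue comes from `rank-one`; in S T₁
    -- T₀ x the new T₀ passes S, whose letters start at 2, and the braid relation turns it into a T₁
    -- acting on x.
    coset-eigen {suc (suc m)} {T} F {x} Tx≈ax zero = begin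
      T₀ * (coset b T * x)                             ≈⟨ *-congˡ expand ⟩
      T₀ * (B * ((b + T₀) * x) + S * (T₁ * (T₀ * x)))  ≈⟨ distribˡ _ _ _ ⟩
      T₀ * (B * ((b + T₀) * x)) + T₀ * (S * (T₁ * (T₀ * x)))  ≈⟨ +-cong first second ⟩
      a * (B * ((b + T₀) * x)) + a * (S * (T₁ * (T₀ * x)))    ≈⟨ distribˡ a _ _ ⟨
      a * (B * ((b + T₀) * x) + S * (T₁ * (T₀ * x)))   ≈⟨ *-congˡ expand ⟨
      a * (coset b T * x)                              ∎
      where
      open HeckeFamily F
      T₀ = T zero
      T₁ = T (suc zero)
      B = b ^ suc m
      B-central = ^-central b-central (suc m)
      S = coset b (λ j → T (suc (suc j)))
      expand : coset b T * x ≈ B * ((b + T₀) * x) + S * (T₁ * (T₀ * x))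
      expand = begin
        (b * B + (B + S * T₁) * T₀) * x            ≈⟨ *-congʳ (+-cong (b-central B) (distribʳ T₀ B _)) ⟩
        (B * b + (B * T₀ + S * T₁ * T₀)) * x       ≈⟨ *-congʳ (+-assoc _ _ _) ⟨
        (B * b + B * T₀ + S * T₁ * T₀) * x         ≈⟨ *-congʳ (+-congʳ (distribˡ B b T₀)) ⟨
        (B * (b + T₀) + S * T₁ * T₀) * x           ≈⟨ distribʳ x _ _ ⟩
        B * (b + T₀) * x + S * T₁ * T₀ * x
          ≈⟨ +-cong (*-assoc B _ x) (trans (*-assoc _ T₀ x) (*-assoc S T₁ _)) ⟩
        B * ((b + T₀) * x) + S * (T₁ * (T₀ * x))   ∎
      first : T₀ * (B * ((b + T₀) * x)) ≈ a * (B * ((b + T₀) * x))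
      first = begin
        T₀ * (B * ((b + T₀) * x))   ≈⟨ central-swap B-central T₀ _ ⟩
        B * (T₀ * ((b + T₀) * x))   ≈⟨ *-congˡ (*-assoc T₀ _ x) ⟨
        B * (T₀ * (b + T₀) * x)     ≈⟨ *-congˡ (*-congʳ (rank-one (quadratic zero))) ⟩
        B * (a * (b + T₀) * x)      ≈⟨ *-congˡ (*-assoc a _ x) ⟩
        B * (a * ((b + T₀) * x))    ≈⟨ central-swap a-central B _ ⟩
        a * (B * ((b + T₀) * x))    ∎
      second : T₀ * (S * (T₁ * (T₀ * x))) ≈ a * (S * (T₁ * (T₀ * x)))
      second = begin
        T₀ * (S * (T₁ * (T₀ * x)))    ≈⟨ *-assoc T₀ S _ ⟨
        T₀ * S * (T₁ * (T₀ * x))      ≈⟨ *-congʳ (intertwines-coset b-central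
                                           (λ j → far (suc (suc j)) zero (s≤s (s≤s z≤n)))) ⟨
        S * T₀ * (T₁ * (T₀ * x))      ≈⟨ *-assoc S T₀ _ ⟩
        S * (T₀ * (T₁ * (T₀ * x)))    ≈⟨ *-congˡ (trans (*-congˡ (sym (*-assoc T₁ T₀ x))) (sym (*-assoc T₀ _ x))) ⟩
        S * (T₀ * (T₁ * T₀) * x)      ≈⟨ *-congˡ (*-congʳ (sym (*-assoc T₀ T₁ T₀))) ⟩
        S * (T₀ * T₁ * T₀ * x)        ≈⟨ *-congˡ (*-congʳ (braid zero (suc zero) ≡.refl)) ⟩
        S * (T₁ * T₀ * T₁ * x)        ≈⟨ *-congˡ (*-assoc _ T₁ x) ⟩
        S * (T₁ * T₀ * (T₁ * x))      ≈⟨ *-congˡ (*-congˡ (Tx≈ax (suc zero) (s≤s z≤n))) ⟩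
        S * (T₁ * T₀ * (a * x))       ≈⟨ *-congˡ (central-swap a-central _ x) ⟩
        S * (a * (T₁ * T₀ * x))       ≈⟨ central-swap a-central S _ ⟩
        a * (S * (T₁ * T₀ * x))       ≈⟨ *-congˡ (*-congˡ (*-assoc T₁ T₀ x)) ⟩
        a * (S * (T₁ * (T₀ * x)))     ∎

    weighted-eigen : ∀ {m} {T : Fin m → Carrier} {γ} → HeckeFamily T γ →
                     ∀ i → T i * weighted b T ≈ a * weighted b T
    weighted-eigen {suc m} {T} F i = begin
      T i * weighted b T                           ≈⟨ *-congˡ (weighted-suc b-central T) ⟩
      T i * (coset b T * weighted b (T ∘ suc))
        ≈⟨ coset-eigen F (λ { (suc j) _ → weighted-eigen (restrict F) j }) i ⟩
      a * (coset b T * weighted b (T ∘ suc))       ≈⟨ *-congˡ (weighted-suc b-central T) ⟨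
      a * weighted b T                             ∎

    -- Each Horner level releases a left factor h = b + q g₀: the first hypothesis turns T₀ (g₀ x)
    -- into h (g₁ x), h commutes with the remaining letters, and b x + q g₀ x = h x absorbs the
    -- other terms. What is left is the same identity for the shifted data.
    coset-product : ∀ {m} {T : Fin m → Carrier} {g : Fin (suc m) → Carrier} {x} →
      (∀ i → T i * (g (inject₁ i) * x) ≈ (b + q * g (inject₁ i)) * (g (suc i) * x)) →
      (∀ i j → toℕ i ℕ.< toℕ j → T j * g i ≈ g i * T j) →
      b ^ suc m * x + q * (coset b T * (g zero * x)) ≈ ∏ (λ j → b + q * g j) * x
    coset-product {zero} {T} {g} {x} _ _ = begin
      b ^ 1 * x + q * (1# * (g zero * x))   ≈⟨ +-cong (*-congʳ (*-identityʳ b)) (*-congˡ (*-identityˡ _)) ⟩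
      b * x + q * (g zero * x)              ≈⟨ +-congˡ (*-assoc q _ x) ⟨
      b * x + q * g zero * x                ≈⟨ distribʳ x _ _ ⟨
      (b + q * g zero) * x                  ≈⟨ *-congʳ (*-identityʳ _) ⟨
      (b + q * g zero) * 1# * x             ∎
    coset-product {suc m} {T} {g} {x} Tgx≈hgx Tg≈gT = begin
      b * B * x + q * ((B + S * T zero) * (g₀ * x))
        ≈⟨ +-cong (trans (*-congʳ (b-central B)) (*-assoc B b x)) (*-congˡ (distribʳ _ B _)) ⟩
      B * (b * x) + q * (B * (g₀ * x) + S * T zero * (g₀ * x))
        ≈⟨ +-congˡ (distribˡ q _ _) ⟩
      B * (b * x) + (q * (B * (g₀ * x)) + q * (S * T zero * (g₀ * x)))
        ≈⟨ +-congˡ (+-cong (sym (central-swap q-central B _)) (*-congˡ (trans (*-assoc S _ _) (*-congˡ (Tgx≈hgx zero))))) ⟩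
      B * (b * x) + (B * (q * (g₀ * x)) + q * (S * (h * (g₁ * x))))
        ≈⟨ +-assoc _ _ _ ⟨
      B * (b * x) + B * (q * (g₀ * x)) + q * (S * (h * (g₁ * x)))
        ≈⟨ +-cong (trans (sym (distribˡ B _ _)) (*-congˡ (trans (+-congˡ (sym (*-assoc q g₀ x))) (sym (distribʳ x b _)))))
                  (*-congˡ (trans (sym (*-assoc S h _)) (trans (*-congʳ S-h) (*-assoc h S _)))) ⟩
      B * (h * x) + q * (h * (S * (g₁ * x)))
        ≈⟨ +-cong (central-swap B-central h x) (central-swap q-central h _) ⟨
      h * (B * x) + h * (q * (S * (g₁ * x)))
        ≈⟨ distribˡ h _ _ ⟨
      h * (B * x + q * (S * (g₁ * x)))
        ≈⟨ *-congˡ (coset-product (Tgx≈hgx ∘ suc) (λ i j i<j → Tg≈gT (suc i) (suc j) (s≤s i<j))) ⟩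
      h * (∏ (λ j → b + q * g (suc j)) * x)
        ≈⟨ *-assoc h _ x ⟨
      ∏ (λ j → b + q * g j) * x  ∎
      where
      B = b ^ suc m
      B-central = ^-central b-central (suc m)
      S = coset b (T ∘ suc)
      g₀ = g zero
      g₁ = g (suc zero)
      h = b + q * g₀
      S-h : S * h ≈ h * S
      S-h = intertwines-coset b-central λ j → intertwines-+ (sym (b-central _))
        (intertwines-* (sym (q-central _)) (Tg≈gT zero (suc j) (s≤s z≤n)))

    -- The sign σ lets one induction serve both cases. After (a, b) ↦ (-b, -a) the expression a γ_ji
    -- + b γ_ij becomes -c_ji; taking σ = -1 restores c_ji and at the same time makes the sum over
    -- the intertwiners alternate.
    module Normalization (σ : Carrier) (σ-central : Central σ) (σσ≈1 : σ * σ ≈ 1#) where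

      -- Writing c ξ = τ in place of ξ = c⁻¹ τ keeps inverses out of the induction; `ξ-γ` is a
      -- separate field because deriving it would mean cancelling c.
      record Normalized {m} (T : Fin m → Carrier) (γ c : Fin (suc m) → Fin (suc m) → Carrier)
                        (ξ : Fin m → Carrier) : Set (e Level.⊔ ℓ) where
        field
          family : HeckeFamily T γ
          c-def  : ∀ i j → c i j ≈ σ * (a * γ j i + b * γ i j)
        open HeckeFamily family public
        field
          c*ξ≈τ  : ∀ i → c (inject₁ i) (suc i) * ξ i ≈ τ i
          ξ-γ    : ∀ i j k → ξ i * γ j k ≈ γ (s i ⟨$⟩ʳ j) (s i ⟨$⟩ʳ k) * ξ i

        intertwines-c : ∀ {t i j k l} → t * γ i j ≈ γ k l * t → t * γ j i ≈ γ l k * t → t * c i j ≈ c k l * t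
        intertwines-c {t} {i} {j} {k} {l} tγij tγji = begin
          t * c i j                              ≈⟨ *-congˡ (c-def i j) ⟩
          t * (σ * (a * γ j i + b * γ i j))      ≈⟨ intertwines-* (sym (σ-central t)) (intertwines-+
                                                      (intertwines-* (sym (a-central t)) tγji)
                                                      (intertwines-* (sym (b-central t)) tγij)) ⟩
          σ * (a * γ l k + b * γ k l) * t        ≈⟨ *-congʳ (c-def k l) ⟨
          c k l * t                              ∎

        ξ-c : ∀ i j k → ξ i * c j k ≈ c (s i ⟨$⟩ʳ j) (s i ⟨$⟩ʳ k) * ξ i
        ξ-c i j k = intertwines-c (ξ-γ i j k) (ξ-γ i k j)

        c-comm : ∀ i j k l → c i j * c k l ≈ c k l * c i j
        c-comm i j k l = intertwines-c (sym (intertwines-c (γ-comm k l i j) (γ-comm k l j i)))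
                                       (sym (intertwines-c (γ-comm l k i j) (γ-comm l k j i)))

        -- From a = b + q and γ_ij + γ_ji = 1 the constant b separates. The right-hand side is the
        -- shape of the factors that `coset-product` produces.
        σc≈b+qγ : ∀ i j → i ≢ j → σ * c j i ≈ b + q * γ i j
        σc≈b+qγ i j i≢j = begin
          σ * c j i                                ≈⟨ *-congˡ (c-def j i) ⟩
          σ * (σ * (a * γ i j + b * γ j i))        ≈⟨ *-assoc σ σ _ ⟨
          σ * σ * (a * γ i j + b * γ j i)          ≈⟨ *-congʳ σσ≈1 ⟩
          1# * (a * γ i j + b * γ j i)             ≈⟨ *-identityˡ _ ⟩
          a * γ i j + b * γ j i                    ≈⟨ +-congʳ (trans (*-congʳ a≈b+q) (distribʳ _ b q)) ⟩
          b * γ i j + q * γ i j + b * γ j i        ≈⟨ +-assoc _ _ _ ⟩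
          b * γ i j + (q * γ i j + b * γ j i)      ≈⟨ +-congˡ (+-comm _ _) ⟩
          b * γ i j + (b * γ j i + q * γ i j)      ≈⟨ +-assoc _ _ _ ⟨
          b * γ i j + b * γ j i + q * γ i j        ≈⟨ +-congʳ (distribˡ b _ _) ⟨
          b * (γ i j + γ j i) + q * γ i j          ≈⟨ +-congʳ (*-congˡ (γ-sum i j i≢j)) ⟩
          b * 1# + q * γ i j                       ≈⟨ +-congʳ (*-identityʳ b) ⟩
          b + q * γ i j                            ∎

      restrictᴺ : ∀ {m T γ c ξ} → Normalized {suc m} T γ c ξ →
                  Normalized (T ∘ suc) (λ i j → γ (suc i) (suc j)) (λ i j → c (suc i) (suc j)) (ξ ∘ suc)
      restrictᴺ {γ = γ} N = record
        { family = restrict N.family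
        ; c-def  = λ i j → N.c-def (suc i) (suc j)
        ; c*ξ≈τ  = λ i → N.c*ξ≈τ (suc i)
        ; ξ-γ    = λ i j k → trans (N.ξ-γ (suc i) (suc j) (suc k))
                     (*-congʳ (reflexive (≡.cong₂ γ (s-suc i j) (s-suc i k))))
        }
        where module N = Normalized N

      -- Substituting T₀ = τ₀ + q γ₀₁ separates the cosets. The part with q γ₀₁, together with the
      -- leading power of b, collapses by `coset-product` to the identity coset (`fixed`). The
      -- vector τ₀ x is again an eigenvector for the letters from 2 on, so the induction hypothesis
      -- yields all other cosets (`shifted`).
      coset-exchange : ∀ {m T γ c ξ} → Normalized {m} T γ c ξ → ∀ {x} → InvariantAbove₀ T x →
                       coset b T * x ≈ coset σ ξ * (∏ (λ j → c (suc j) zero) * x)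
      coset-exchange {zero}  N {x} _ = *-congˡ (sym (*-identityˡ x))
      coset-exchange {suc m} {T} {γ} {c} {ξ} N {x} Tx≈ax = begin
        (b ^ suc m + S * T zero) * x                    ≈⟨ distribʳ x _ _ ⟩
        b ^ suc m * x + S * T zero * x                  ≈⟨ +-congˡ (*-assoc S _ x) ⟩
        b ^ suc m * x + S * (T zero * x)                ≈⟨ +-congˡ (*-congˡ T₀x≈) ⟩
        b ^ suc m * x + S * (q * (γ₀₁ * x) + τ₀ * x)    ≈⟨ +-congˡ (distribˡ S _ _) ⟩
        b ^ suc m * x + (S * (q * (γ₀₁ * x)) + S * (τ₀ * x))  ≈⟨ +-assoc _ _ _ ⟨
        b ^ suc m * x + S * (q * (γ₀₁ * x)) + S * (τ₀ * x)    ≈⟨ +-congʳ (+-congˡ (central-swap q-central S _)) ⟩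
        b ^ suc m * x + q * (S * (γ₀₁ * x)) + S * (τ₀ * x)    ≈⟨ +-cong fixed shifted ⟩
        σ ^ suc m * (G * x) + S′ * ξ zero * (G * x)     ≈⟨ distribʳ (G * x) _ _ ⟨
        (σ ^ suc m + S′ * ξ zero) * (G * x)             ∎
        where
        open Normalized N
        S   = coset b (T ∘ suc)
        S′  = coset σ (ξ ∘ suc)
        γ₀₁ = γ zero (suc zero)
        τ₀  = τ zero
        G   = ∏ (λ j → c (suc j) zero)

        T₀x≈ : T zero * x ≈ q * (γ₀₁ * x) + τ₀ * x
        T₀x≈ = begin
          T zero * x                  ≈⟨ *-congʳ (trans (T≈τ+qγ zero) (+-comm _ _)) ⟩
          (q * γ₀₁ + τ₀) * x          ≈⟨ distribʳ x _ _ ⟩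
          q * γ₀₁ * x + τ₀ * x        ≈⟨ +-congʳ (*-assoc q γ₀₁ x) ⟩
          q * (γ₀₁ * x) + τ₀ * x      ∎

        -- In T = τ + q γᵢⱼ the part τ carries γ₀ᵢ to γ₀ⱼ. Adding γ₀ⱼ q γᵢⱼ x to both sides
        -- completes τ x to T x = (b + q) x, so that τ disappears, and `γ-cocycle` for 0, i, j
        -- matches the quadratic terms.
        propagate : ∀ i → T (suc i) * (γ zero (suc (inject₁ i)) * x) ≈
                          (b + q * γ zero (suc (inject₁ i))) * (γ zero (suc (suc i)) * x)
        propagate i = +-cancelʳ (γ₀ⱼ * (q * (γᵢⱼ * x))) _ _ (begin
          T (suc i) * (γ₀ᵢ * x) + γ₀ⱼ * (q * (γᵢⱼ * x))
            ≈⟨ +-congʳ (trans (*-congʳ (T≈τ+qγ (suc i))) (distribʳ _ _ _)) ⟩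
          τ (suc i) * (γ₀ᵢ * x) + q * γᵢⱼ * (γ₀ᵢ * x) + γ₀ⱼ * (q * (γᵢⱼ * x))
            ≈⟨ +-congʳ (+-congʳ (trans (sym (*-assoc _ _ x)) (trans (*-congʳ τγ) (*-assoc _ _ x)))) ⟩
          γ₀ⱼ * (τ (suc i) * x) + q * γᵢⱼ * (γ₀ᵢ * x) + γ₀ⱼ * (q * (γᵢⱼ * x))
            ≈⟨ trans (+-assoc _ _ _) (trans (+-congˡ (+-comm _ _)) (sym (+-assoc _ _ _))) ⟩
          γ₀ⱼ * (τ (suc i) * x) + γ₀ⱼ * (q * (γᵢⱼ * x)) + q * γᵢⱼ * (γ₀ᵢ * x)
            ≈⟨ +-congʳ (trans (sym (distribˡ γ₀ⱼ _ _)) (*-congˡ τx+qγx)) ⟩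
          γ₀ⱼ * ((b + q) * x) + q * γᵢⱼ * (γ₀ᵢ * x)
            ≈⟨ +-cong (trans (sym (*-assoc _ _ x)) (*-congʳ (trans (distribˡ _ b q) (sym (+-cong (b-central _) (q-central _))))))
                      (trans (sym (*-assoc _ _ x)) (*-congʳ (trans (*-assoc q _ _) (*-congˡ (γ-comm _ _ _ _))))) ⟩
          (b * γ₀ⱼ + q * γ₀ⱼ) * x + q * (γ₀ᵢ * γᵢⱼ) * x
            ≈⟨ distribʳ x _ _ ⟨
          (b * γ₀ⱼ + q * γ₀ⱼ + q * (γ₀ᵢ * γᵢⱼ)) * x
            ≈⟨ *-congʳ (trans (+-assoc _ _ _) (+-congˡ (sym (distribˡ q _ _)))) ⟩
          (b * γ₀ⱼ + q * (γ₀ⱼ + γ₀ᵢ * γᵢⱼ)) * x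
            ≈⟨ *-congʳ (+-congˡ (*-congˡ (γ-cocycle zero _ _ (λ ()) i≢j (λ ())))) ⟩
          (b * γ₀ⱼ + q * (γ₀ᵢ * γ₀ⱼ + γ₀ⱼ * γᵢⱼ)) * x
            ≈⟨ *-congʳ (trans (+-congˡ (distribˡ q _ _)) (sym (+-assoc _ _ _))) ⟩
          (b * γ₀ⱼ + q * (γ₀ᵢ * γ₀ⱼ) + q * (γ₀ⱼ * γᵢⱼ)) * x
            ≈⟨ distribʳ x _ _ ⟩
          (b * γ₀ⱼ + q * (γ₀ᵢ * γ₀ⱼ)) * x + q * (γ₀ⱼ * γᵢⱼ) * x
            ≈⟨ +-cong (*-congʳ (trans (+-congˡ (sym (*-assoc q _ _))) (sym (distribʳ γ₀ⱼ b _))))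
                      (trans (*-assoc q _ x) (trans (*-congˡ (*-assoc _ _ x)) (sym (central-swap q-central _ _)))) ⟩
          (b + q * γ₀ᵢ) * γ₀ⱼ * x + γ₀ⱼ * (q * (γᵢⱼ * x))
            ≈⟨ +-congʳ (*-assoc _ _ x) ⟩
          (b + q * γ₀ᵢ) * (γ₀ⱼ * x) + γ₀ⱼ * (q * (γᵢⱼ * x))  ∎)
          where
          γ₀ᵢ = γ zero (suc (inject₁ i))
          γ₀ⱼ = γ zero (suc (suc i))
          γᵢⱼ = γ (suc (inject₁ i)) (suc (suc i))
          i≢j : suc (inject₁ i) ≢ suc (suc i)
          i≢j = inject₁≢suc i ∘ Fin.suc-injective
          τγ : τ (suc i) * γ₀ᵢ ≈ γ₀ⱼ * τ (suc i)
          τγ = trans (intertwines (suc i) zero (suc (inject₁ i)))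
                 (*-congʳ (reflexive (≡.cong (γ zero) (s-inject₁ (suc i)))))
          τx+qγx : τ (suc i) * x + q * (γᵢⱼ * x) ≈ (b + q) * x
          τx+qγx = begin
            τ (suc i) * x + q * (γᵢⱼ * x)   ≈⟨ +-congˡ (*-assoc q _ x) ⟨
            τ (suc i) * x + q * γᵢⱼ * x     ≈⟨ distribʳ x _ _ ⟨
            (τ (suc i) + q * γᵢⱼ) * x       ≈⟨ *-congʳ (T≈τ+qγ (suc i)) ⟨
            T (suc i) * x                   ≈⟨ Tx≈ax (suc i) (s≤s z≤n) ⟩
            a * x                           ≈⟨ *-congʳ a≈b+q ⟩
            (b + q) * x                     ∎

        fixed : b ^ suc m * x + q * (S * (γ₀₁ * x)) ≈ σ ^ suc m * (G * x)
        fixed = begin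
          b ^ suc m * x + q * (S * (γ₀₁ * x))
            ≈⟨ coset-product {T = T ∘ suc} {g = λ j → γ zero (suc j)} propagate
                 (λ i j i<j → intertwines-T (suc j) zero (suc i) ≡.refl (s-below (suc j) (suc i) (s≤s i<j))) ⟩
          ∏ (λ j → b + q * γ zero (suc j)) * x   ≈⟨ *-congʳ (∏-cong (λ j → σc≈b+qγ zero (suc j) λ ())) ⟨
          ∏ (λ j → σ * c (suc j) zero) * x       ≈⟨ *-congʳ (∏-scale σ-central (λ j → c (suc j) zero)) ⟩
          σ ^ suc m * G * x                      ≈⟨ *-assoc _ G x ⟩
          σ ^ suc m * (G * x)                    ∎

        τ₀x-invariant : InvariantAbove₀ (T ∘ suc) (τ₀ * x)
        τ₀x-invariant (suc j) _ = begin
          T (suc (suc j)) * (τ₀ * x)   ≈⟨ *-assoc _ _ _ ⟨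
          T (suc (suc j)) * τ₀ * x     ≈⟨ *-congʳ Tτ≈τT ⟩
          τ₀ * T (suc (suc j)) * x     ≈⟨ *-assoc _ _ _ ⟩
          τ₀ * (T (suc (suc j)) * x)   ≈⟨ *-congˡ (Tx≈ax (suc (suc j)) (s≤s z≤n)) ⟩
          τ₀ * (a * x)                 ≈⟨ central-swap a-central _ x ⟩
          a * (τ₀ * x)                 ∎
          where
          Tτ≈τT : T (suc (suc j)) * τ₀ ≈ τ₀ * T (suc (suc j))
          Tτ≈τT = +-cancelʳ (T (suc (suc j)) * (q * γ₀₁)) _ _ (begin
            T (suc (suc j)) * τ₀ + T (suc (suc j)) * (q * γ₀₁)   ≈⟨ distribˡ _ _ _ ⟨
            T (suc (suc j)) * (τ₀ + q * γ₀₁)                     ≈⟨ *-congˡ (T≈τ+qγ zero) ⟨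
            T (suc (suc j)) * T zero                             ≈⟨ far (suc (suc j)) zero (s≤s (s≤s z≤n)) ⟩
            T zero * T (suc (suc j))                             ≈⟨ *-congʳ (T≈τ+qγ zero) ⟩
            (τ₀ + q * γ₀₁) * T (suc (suc j))                     ≈⟨ distribʳ _ _ _ ⟩
            τ₀ * T (suc (suc j)) + q * γ₀₁ * T (suc (suc j))
              ≈⟨ +-congˡ (intertwines-* (sym (q-central _)) (intertwines-T (suc (suc j)) zero (suc zero) ≡.refl ≡.refl)) ⟨
            τ₀ * T (suc (suc j)) + T (suc (suc j)) * (q * γ₀₁)   ∎)

        shifted : S * (τ₀ * x) ≈ S′ * ξ zero * (G * x)
        shifted = begin
          S * (τ₀ * x)                          ≈⟨ coset-exchange (restrictᴺ N) τ₀x-invariant ⟩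
          S′ * (R₁ * (τ₀ * x))                  ≈⟨ *-congˡ (*-assoc R₁ τ₀ x) ⟨
          S′ * (R₁ * τ₀ * x)                    ≈⟨ *-congˡ (*-congʳ R₁τ₀≈ξ₀G) ⟩
          S′ * (ξ zero * G * x)                 ≈⟨ *-congˡ (*-assoc (ξ zero) G x) ⟩
          S′ * (ξ zero * (G * x))               ≈⟨ *-assoc S′ _ _ ⟨
          S′ * ξ zero * (G * x)                 ∎
          where
          R₀ = ∏ (λ j → c (suc (suc j)) zero)
          R₁ = ∏ (λ j → c (suc (suc j)) (suc zero))
          -- The transposition s₀ carries the factors c_j0 of G to c_j1, except c₁₀, which becomes
          -- c₀₁. The product R₁ lacks exactly this factor, and c₀₁ ξ₀ = τ₀ supplies it.
          R₁τ₀≈ξ₀G : R₁ * τ₀ ≈ ξ zero * G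
          R₁τ₀≈ξ₀G = begin
            R₁ * τ₀                                    ≈⟨ *-congˡ (c*ξ≈τ zero) ⟨
            R₁ * (c zero (suc zero) * ξ zero)          ≈⟨ *-assoc R₁ _ _ ⟨
            R₁ * c zero (suc zero) * ξ zero
              ≈⟨ *-congʳ (intertwines-∏ (λ j → c-comm zero (suc zero) (suc (suc j)) (suc zero))) ⟨
            c zero (suc zero) * R₁ * ξ zero            ≈⟨ intertwines-* (ξ-c zero (suc zero) zero)
                                                            (intertwines-∏ (λ j → ξ-c zero (suc (suc j)) zero)) ⟨
            ξ zero * (c (suc zero) zero * R₀)          ∎

      symmetrizer-factors : ∀ {m T γ c ξ} → Normalized {m} T γ c ξ →
                            weighted b T ≈ weighted σ ξ * ∏< (λ i j → c j i)
      symmetrizer-factors {zero} {T} {ξ = ξ} N = begin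
        weighted b T        ≈⟨ weighted-zero b T ⟩
        1#                  ≈⟨ weighted-zero σ ξ ⟨
        weighted σ ξ        ≈⟨ *-identityʳ _ ⟨
        weighted σ ξ * 1#   ≈⟨ *-congˡ (*-identityʳ 1#) ⟨
        weighted σ ξ * (1# * 1#) ∎
      symmetrizer-factors {suc m} {T} {γ} {c} {ξ} N = begin
        weighted b T                                ≈⟨ weighted-suc b-central T ⟩
        coset b T * weighted b (T ∘ suc)
          ≈⟨ coset-exchange N (λ { (suc j) _ → weighted-eigen (restrict family) j }) ⟩
        coset σ ξ * (G * weighted b (T ∘ suc))      ≈⟨ *-congˡ (*-congˡ (symmetrizer-factors (restrictᴺ N))) ⟩
        coset σ ξ * (G * (V * P))                   ≈⟨ *-congˡ (*-assoc G V P) ⟨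
        coset σ ξ * (G * V * P)                     ≈⟨ *-congˡ (*-congʳ (intertwines-weighted σ-central ξG≈Gξ)) ⟨
        coset σ ξ * (V * G * P)                     ≈⟨ *-congˡ (*-assoc V G P) ⟩
        coset σ ξ * (V * (G * P))                   ≈⟨ *-assoc _ V _ ⟨
        coset σ ξ * V * (G * P)                     ≈⟨ *-congʳ (weighted-suc σ-central ξ) ⟨
        weighted σ ξ * (G * P)                      ∎
        where
        open Normalized N
        G = ∏ (λ j → c (suc j) zero)
        V = weighted σ (ξ ∘ suc)
        P = ∏< (λ i j → c (suc j) (suc i))
        ξG≈Gξ : ∀ i → ξ (suc i) * G ≈ G * ξ (suc i)
        ξG≈Gξ i = swap-∏ i (c-comm _ _ _ _) λ j →
          trans (ξ-c (suc i) (suc j) zero) (*-congʳ (reflexive (≡.cong (λ k → c k zero) (s-suc i j))))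

      normalize : ∀ {m T γ} {c : Fin (suc m) → Fin (suc m) → Carrier} {ξ κ : Fin m → Carrier} (F : HeckeFamily T γ) →
                  (∀ i j → c i j ≈ σ * (a * γ j i + b * γ i j)) →
                  (∀ i → c (inject₁ i) (suc i) * κ i ≈ 1#) → (∀ i → κ i * c (inject₁ i) (suc i) ≈ 1#) →
                  (∀ i → ξ i ≈ κ i * HeckeFamily.τ F i) → Normalized T γ c ξ
      normalize {T = T} {γ} {c} {ξ} {κ} F c-def cκ≈1 κc≈1 ξ≈κτ = record
        { family = F
        ; c-def  = c-def
        ; c*ξ≈τ  = λ i → begin
            c (inject₁ i) (suc i) * ξ i             ≈⟨ *-congˡ (ξ≈κτ i) ⟩
            c (inject₁ i) (suc i) * (κ i * τ i)     ≈⟨ *-assoc _ _ _ ⟨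
            c (inject₁ i) (suc i) * κ i * τ i       ≈⟨ *-congʳ (cκ≈1 i) ⟩
            1# * τ i                                ≈⟨ *-identityˡ _ ⟩
            τ i                                     ∎
        ; ξ-γ    = λ i j k → begin
            ξ i * γ j k                                   ≈⟨ *-congʳ (ξ≈κτ i) ⟩
            κ i * τ i * γ j k                             ≈⟨ intertwines-*ˡ (κγ≈γκ i _ _) (intertwines i j k) ⟩
            γ (s i ⟨$⟩ʳ j) (s i ⟨$⟩ʳ k) * (κ i * τ i)     ≈⟨ *-congˡ (ξ≈κτ i) ⟨
            γ (s i ⟨$⟩ʳ j) (s i ⟨$⟩ʳ k) * ξ i             ∎
        }
        where
        open HeckeFamily F
        γc≈cγ : ∀ i j k l → γ k l * c i j ≈ c i j * γ k l
        γc≈cγ i j k l = begin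
          γ k l * c i j                              ≈⟨ *-congˡ (c-def i j) ⟩
          γ k l * (σ * (a * γ j i + b * γ i j))      ≈⟨ intertwines-* (sym (σ-central _)) (intertwines-+
                                                          (intertwines-* (sym (a-central _)) (γ-comm k l j i))
                                                          (intertwines-* (sym (b-central _)) (γ-comm k l i j))) ⟩
          σ * (a * γ j i + b * γ i j) * γ k l        ≈⟨ *-congʳ (c-def i j) ⟨
          c i j * γ k l                              ∎
        κγ≈γκ : ∀ i k l → κ i * γ k l ≈ γ k l * κ i
        κγ≈γκ i k l = sym (intertwines-inverse (cκ≈1 i) (κc≈1 i) (γc≈cγ _ _ k l))

  -- The antisymmetrizer by substitution and conjugation

  module Parameters (a b : Carrier) (a-central : Central a) (b-central : Central b)
    (a≈b+q : a ≈ b + q) (ab≈1 : a * b ≈ 1#) where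

    -1-central : Central (- 1#)
    -1-central x = trans (-1*x≈-x x) (trans (-‿cong (sym (*-identityʳ x))) (-‿distribʳ-* x 1#))

    -‿central : ∀ {z} → Central z → Central (- z)
    -‿central {z} z-central x = begin
      - z * x      ≈⟨ -‿distribˡ-* z x ⟨
      - (z * x)    ≈⟨ -‿cong (z-central x) ⟩
      - (x * z)    ≈⟨ -‿distribʳ-* x z ⟩
      x * - z      ∎

    -x*-y≈x*y : ∀ x y → - x * - y ≈ x * y
    -x*-y≈x*y x y = begin
      - x * - y      ≈⟨ -‿distribˡ-* x (- y) ⟨
      - (x * - y)    ≈⟨ -‿cong (-‿distribʳ-* x y) ⟨
      - - (x * y)    ≈⟨ -‿involutive _ ⟩
      x * y          ∎

    -b≈-a+q : - b ≈ - a + q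
    -b≈-a+q = sym (begin
      - a + q              ≈⟨ +-congʳ (-‿cong a≈b+q) ⟩
      - (b + q) + q        ≈⟨ +-congʳ (-‿+-comm b q) ⟨
      - b + - q + q        ≈⟨ +-assoc _ _ _ ⟩
      - b + (- q + q)      ≈⟨ +-congˡ (-‿inverseˡ q) ⟩
      - b + 0#             ≈⟨ +-identityʳ _ ⟩
      - b                  ∎)

    -- The substitution (a, b) ↦ (-b, -a) preserves q, hence the Hecke relations,
    -- and exchanges the symmetrizer with the antisymmetrizer and c i j with - c j i.
    module Symmetric     = Eigenvalues a b a-central b-central a≈b+q ab≈1
    module Antisymmetric = Eigenvalues (- b) (- a) (-‿central b-central) (-‿central a-central) -b≈-a+q
                             (trans (-x*-y≈x*y b a) (trans (b-central a) ab≈1))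
    module S = Symmetric.Normalization 1# 1-central (*-identityˡ 1#)
    module A = Antisymmetric.Normalization (- 1#) -1-central (trans (-x*-y≈x*y 1# 1#) (*-identityˡ 1#))

    transposed-c-def : ∀ x y → a * y + b * x ≈ - 1# * (- b * x + - a * y)
    transposed-c-def x y = sym (begin
      - 1# * (- b * x + - a * y)      ≈⟨ distribˡ _ _ _ ⟩
      - 1# * (- b * x) + - 1# * (- a * y)  ≈⟨ +-cong (cancel b x) (cancel a y) ⟩
      b * x + a * y                   ≈⟨ +-comm _ _ ⟩
      a * y + b * x                   ∎)
      where
      cancel : ∀ z x → - 1# * (- z * x) ≈ z * x
      cancel z x = begin
        - 1# * (- z * x)    ≈⟨ *-assoc _ _ x ⟨
        - 1# * - z * x      ≈⟨ *-congʳ (trans (-x*-y≈x*y 1# z) (*-identityˡ z)) ⟩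
        z * x               ∎

    ∏<-fixed : ∀ {t n} (f : Fin n → Fin n → Carrier) → (∀ i j → t * f i j ≈ f i j * t) → t * ∏< f ≈ ∏< f * t
    ∏<-fixed {n = zero}  f tf≈ft = sym (1-central _)
    ∏<-fixed {n = suc n} f tf≈ft = intertwines-* (intertwines-∏ (λ j → tf≈ft zero (suc j)))
      (∏<-fixed (λ i j → f (suc i) (suc j)) (λ i j → tf≈ft (suc i) (suc j)))

    -- The transposition s_i permutes the factors c_jk with j < k except c_{i,i+1}, which it flips,
    -- and the flip accounts for the change of normalization: ζ_i c_{i,i+1} = c_{i+1,i} ζ_i = τ_i =
    -- c_{i,i+1} ξ_i. A letter above 0 only permutes the row of 0, so induction handles the rest.
    conjugate-∏< : ∀ {m T γ c ξ ζ} → S.Normalized {m} T γ c ξ → A.Normalized T γ (λ i j → c j i) ζ →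
                   ∀ i → ζ i * ∏< c ≈ ∏< c * ξ i
    conjugate-∏< {c = c} {ξ} {ζ} N N′ (suc i) = sym (intertwines-*ˡ
      (sym (swap-∏ i (N.c-comm _ _ _ _) λ j →
        trans (N′.ξ-c (suc i) (suc j) zero) (*-congʳ (reflexive (≡.cong (c zero) (s-suc i j))))))
      (sym (conjugate-∏< (S.restrictᴺ N) (A.restrictᴺ N′) i)))
      where
      module N  = S.Normalized N
      module N′ = A.Normalized N′
    conjugate-∏< {suc m} {c = c} {ξ} {ζ} N N′ zero = begin
      ζ₀ * (c₀₁ * R₀ * (R₁ * P))   ≈⟨ *-congˡ (*-assoc c₀₁ R₀ _) ⟩
      ζ₀ * (c₀₁ * (R₀ * (R₁ * P))) ≈⟨ *-assoc ζ₀ c₀₁ _ ⟨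
      ζ₀ * c₀₁ * (R₀ * (R₁ * P))   ≈⟨ *-congʳ ζc≈cξ ⟩
      c₀₁ * ξ₀ * (R₀ * (R₁ * P))   ≈⟨ *-assoc c₀₁ ξ₀ _ ⟩
      c₀₁ * (ξ₀ * (R₀ * (R₁ * P))) ≈⟨ *-congˡ ξRRP≈RRPξ ⟩
      c₀₁ * (R₀ * (R₁ * P) * ξ₀)   ≈⟨ *-assoc c₀₁ _ ξ₀ ⟨
      c₀₁ * (R₀ * (R₁ * P)) * ξ₀   ≈⟨ *-congʳ (*-assoc c₀₁ R₀ _) ⟨
      c₀₁ * R₀ * (R₁ * P) * ξ₀     ∎
      where
      module N  = S.Normalized N
      module N′ = A.Normalized N′
      ξ₀  = ξ zero
      ζ₀  = ζ zero
      c₀₁ = c zero (suc zero)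
      R₀  = ∏ (λ j → c zero (suc (suc j)))
      R₁  = ∏ (λ j → c (suc zero) (suc (suc j)))
      P   = ∏< (λ i j → c (suc (suc i)) (suc (suc j)))
      ζc≈cξ : ζ₀ * c₀₁ ≈ c₀₁ * ξ₀
      ζc≈cξ = trans (N′.ξ-c zero (suc zero) zero) (trans (N′.c*ξ≈τ zero) (sym (N.c*ξ≈τ zero)))
      row : Fin (suc (suc m)) → Fin m → Carrier
      row i j = c i (suc (suc j))
      R₁R₀≈R₀R₁ : R₁ * R₀ ≈ R₀ * R₁
      R₁R₀≈R₀R₁ = intertwines-∏ {f = row zero} {g = row zero} λ j →
        sym (intertwines-∏ {f = row (suc zero)} {g = row (suc zero)} λ k → N.c-comm _ _ _ _)
      -- Apart from c₀₁, s₀ exchanges the rows of 0 and 1, which commute, and fixes every later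
      -- factor.
      ξRRP≈RRPξ : ξ₀ * (R₀ * (R₁ * P)) ≈ R₀ * (R₁ * P) * ξ₀
      ξRRP≈RRPξ = begin
        ξ₀ * (R₀ * (R₁ * P))    ≈⟨ intertwines-* (intertwines-∏ (λ j → N.ξ-c zero zero (suc (suc j))))
                                     (intertwines-* (intertwines-∏ (λ j → N.ξ-c zero (suc zero) (suc (suc j))))
                                       (∏<-fixed _ (λ i j → N.ξ-c zero (suc (suc i)) (suc (suc j))))) ⟩
        R₁ * (R₀ * P) * ξ₀      ≈⟨ *-congʳ (*-assoc R₁ R₀ P) ⟨
        R₁ * R₀ * P * ξ₀        ≈⟨ *-congʳ (*-congʳ R₁R₀≈R₀R₁) ⟩
        R₀ * R₁ * P * ξ₀        ≈⟨ *-congʳ (*-assoc R₀ R₁ P) ⟩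
        R₀ * (R₁ * P) * ξ₀      ∎

    module _ {m} {T : Fin m → Carrier} {γ : Fin (suc m) → Fin (suc m) → Carrier} (F : HeckeFamily T γ) where

      open HeckeFamily F using (τ)

      private
        c : Fin (suc m) → Fin (suc m) → Carrier
        c i j = a * γ j i + b * γ i j

      module _ {ξ κ : Fin m → Carrier}
        (cκ≈1 : ∀ i → c (inject₁ i) (suc i) * κ i ≈ 1#) (κc≈1 : ∀ i → κ i * c (inject₁ i) (suc i) ≈ 1#)
        where

        symmetrizer-factors : (∀ i → ξ i ≈ κ i * τ i) → weighted b T ≈ weighted 1# ξ * ∏< (λ i j → c j i)
        symmetrizer-factors ξ≈κτ =
          S.symmetrizer-factors (S.normalize F (λ i j → sym (*-identityˡ _)) cκ≈1 κc≈1 ξ≈κτ)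

        -- Under the substituted parameters the intertwiners are normalized by c_{i+1,i}, with
        -- inverse κ′, and the product of the c_ij stands on the right. Moving it to the left
        -- renormalizes ζ to ξ.
        antisymmetrizer-factors : {κ′ : Fin m → Carrier} →
          (∀ i → c (suc i) (inject₁ i) * κ′ i ≈ 1#) → (∀ i → κ′ i * c (suc i) (inject₁ i) ≈ 1#) →
          (∀ i → ξ i ≈ κ i * τ i) → weighted (- a) T ≈ ∏< c * weighted (- 1#) ξ
        antisymmetrizer-factors {κ′} cκ′≈1 κ′c≈1 ξ≈κτ = trans (A.symmetrizer-factors ζ-normalized)
          (intertwines-weighted -1-central (conjugate-∏< ξ-normalized ζ-normalized))
          where
          ζ : Fin m → Carrier
          ζ i = κ′ i * τ i
          ξ-normalized : S.Normalized T γ c ξ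
          ξ-normalized = S.normalize F (λ i j → sym (*-identityˡ _)) cκ≈1 κc≈1 ξ≈κτ
          ζ-normalized : A.Normalized T γ (λ i j → c j i) ζ
          ζ-normalized = A.normalize F (λ i j → transposed-c-def (γ j i) (γ i j)) cκ′≈1 κ′c≈1 (λ i → refl)

-- Hecke families from commuting invertible variables

module LaurentFamilies {e ℓ} (A : Ring e ℓ)
  (q : Ring.Carrier A) (q-central : RingProducts.Central A q) where

  open Ring A hiding (zero)
  open RingProducts A
  open HeckeFamilies A q q-central using (HeckeFamily)
  open RingProperties A using (+-cancelʳ; -‿distribˡ-*; -‿distribʳ-*)
  open SetoidReasoning setoid

  module Variables
    {m} (T : Fin m → Carrier) (W W⁻¹ : Fin (suc m) → Carrier)
    (W-comm : ∀ i j → W i * W j ≈ W j * W i)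
    (W*W⁻¹≈1 : ∀ i → W i * W⁻¹ i ≈ 1#) (W⁻¹*W≈1 : ∀ i → W⁻¹ i * W i ≈ 1#)
    (D : ∀ i j → i ≢ j → Carrier)
    (D-inverseˡ : ∀ i j i≢j → D i j i≢j * (1# - W i * W⁻¹ j) ≈ 1#)
    (D-inverseʳ : ∀ i j i≢j → (1# - W i * W⁻¹ j) * D i j i≢j ≈ 1#)
    where

    -- γ is total so that it can be reindexed by permutations without carrying proofs of i ≢ j. On
    -- the diagonal, where E vanishes, the filler 0 keeps commutation and intertwining true.
    u E γ : Fin (suc m) → Fin (suc m) → Carrier
    u i j = W i * W⁻¹ j
    E i j = 1# - u i j
    γ i j with i Fin.≟ j
    ... | yes _  = 0#
    ... | no i≢j = D i j i≢j

    E+u≈1 : ∀ i j → E i j + u i j ≈ 1#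
    E+u≈1 i j = trans (+-assoc _ _ _) (trans (+-congˡ (-‿inverseˡ _)) (+-identityʳ 1#))

    γ*E≈1 : ∀ {i j} → i ≢ j → γ i j * E i j ≈ 1#
    γ*E≈1 {i} {j} i≢j with i Fin.≟ j
    ... | yes i≡j = contradiction i≡j i≢j
    ... | no  p   = D-inverseˡ i j p

    E*γ≈1 : ∀ {i j} → i ≢ j → E i j * γ i j ≈ 1#
    E*γ≈1 {i} {j} i≢j with i Fin.≟ j
    ... | yes i≡j = contradiction i≡j i≢j
    ... | no  p   = D-inverseʳ i j p

    γ-diagonal : ∀ i → γ i i ≈ 0#
    γ-diagonal i with i Fin.≟ i
    ... | yes _  = refl
    ... | no i≢i = contradiction ≡.refl i≢i

    -- Since `D` takes a proof of i ≢ j as an argument, uniqueness of inverses is what identifies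
    -- its values with γ.
    γ-unique : ∀ {i j x} → i ≢ j → x * E i j ≈ 1# → x ≈ γ i j
    γ-unique {i} {j} {x} i≢j xE≈1 = begin
      x                      ≈⟨ *-identityʳ x ⟨
      x * 1#                 ≈⟨ *-congˡ (E*γ≈1 i≢j) ⟨
      x * (E i j * γ i j)    ≈⟨ *-assoc _ _ _ ⟨
      x * E i j * γ i j      ≈⟨ *-congʳ xE≈1 ⟩
      1# * γ i j             ≈⟨ *-identityˡ _ ⟩
      γ i j                  ∎

    γ≈1+γu : ∀ {i j} → i ≢ j → γ i j ≈ 1# + γ i j * u i j
    γ≈1+γu {i} {j} i≢j = begin
      γ i j                              ≈⟨ *-identityʳ _ ⟨
      γ i j * 1#                         ≈⟨ *-congˡ (E+u≈1 i j) ⟨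
      γ i j * (E i j + u i j)            ≈⟨ distribˡ _ _ _ ⟩
      γ i j * E i j + γ i j * u i j      ≈⟨ +-congʳ (γ*E≈1 i≢j) ⟩
      1# + γ i j * u i j                 ∎

    -- Taking π = id gives all commutation rules for γ, and π = s_i its exchange with τ_i.
    -- Injectivity of π keeps distinct indices distinct, so that the image fraction is defined.
    module _ {t} {π : Fin (suc m) → Fin (suc m)} (tW≈Wt : ∀ j → t * W j ≈ W (π j) * t) where

      intertwines-u : ∀ j k → t * u j k ≈ u (π j) (π k) * t
      intertwines-u j k = intertwines-* (tW≈Wt j) (intertwines-inverse (W*W⁻¹≈1 k) (W⁻¹*W≈1 (π k)) (tW≈Wt k))

      intertwines-E : ∀ j k → t * E j k ≈ E (π j) (π k) * t
      intertwines-E j k = intertwines-+ (sym (1-central t)) (begin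
        t * - u j k              ≈⟨ -‿distribʳ-* t _ ⟨
        - (t * u j k)            ≈⟨ -‿cong (intertwines-u j k) ⟩
        - (u (π j) (π k) * t)    ≈⟨ -‿distribˡ-* _ t ⟩
        - u (π j) (π k) * t      ∎)

      intertwines-γ : (∀ {j k} → π j ≡ π k → j ≡ k) → ∀ j k → t * γ j k ≈ γ (π j) (π k) * t
      intertwines-γ π-injective j k with j Fin.≟ k
      ... | yes ≡.refl = trans (zeroʳ t) (sym (trans (*-congʳ (γ-diagonal (π j))) (zeroˡ t)))
      ... | no  j≢k    = intertwines-inverse (D-inverseʳ j k j≢k) (γ*E≈1 (j≢k ∘ π-injective)) (intertwines-E j k)

    γ-W : ∀ i j k → γ i j * W k ≈ W k * γ i j
    γ-W i j k = sym (intertwines-γ {π = id} (W-comm k) id i j)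

    γ-comm : ∀ i j k l → γ i j * γ k l ≈ γ k l * γ i j
    γ-comm i j = intertwines-γ {π = id} (γ-W i j) id

    γ-u : ∀ i j k l → γ i j * u k l ≈ u k l * γ i j
    γ-u i j = intertwines-u {π = id} (γ-W i j)

    u-chain : ∀ i j k → u i j * u j k ≈ u i k
    u-chain i j k = begin
      W i * W⁻¹ j * (W j * W⁻¹ k)    ≈⟨ *-assoc _ _ _ ⟩
      W i * (W⁻¹ j * (W j * W⁻¹ k))  ≈⟨ *-congˡ (*-assoc _ _ _) ⟨
      W i * (W⁻¹ j * W j * W⁻¹ k)    ≈⟨ *-congˡ (*-congʳ (W⁻¹*W≈1 j)) ⟩
      W i * (1# * W⁻¹ k)             ≈⟨ *-congˡ (*-identityˡ _) ⟩
      u i k                          ∎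

    E-chain : ∀ i j k → E i j + u i j * E j k ≈ E i k
    E-chain i j k = +-cancelʳ (u i k) _ _ (begin
      E i j + u i j * E j k + u i k            ≈⟨ +-assoc _ _ _ ⟩
      E i j + (u i j * E j k + u i k)          ≈⟨ +-congˡ (+-congˡ (u-chain i j k)) ⟨
      E i j + (u i j * E j k + u i j * u j k)  ≈⟨ +-congˡ (distribˡ _ _ _) ⟨
      E i j + u i j * (E j k + u j k)          ≈⟨ +-congˡ (trans (*-congˡ (E+u≈1 j k)) (*-identityʳ _)) ⟩
      E i j + u i j                            ≈⟨ trans (E+u≈1 i j) (sym (E+u≈1 i k)) ⟩
      E i k + u i k                            ∎)

    -- Insert γ i k * E i k = 1 and expand E i k = E i j + u i j * E j k; each summand cancels one
    -- of the two fractions.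
    γ-product : ∀ i j k → i ≢ j → j ≢ k → i ≢ k → γ i j * γ j k ≈ γ i k * (u i j * γ i j + γ j k)
    γ-product i j k i≢j j≢k i≢k = begin
      γ i j * γ j k                                  ≈⟨ *-identityˡ _ ⟨
      1# * (γ i j * γ j k)                           ≈⟨ *-congʳ (γ*E≈1 i≢k) ⟨
      γ i k * E i k * (γ i j * γ j k)                ≈⟨ *-assoc _ _ _ ⟩
      γ i k * (E i k * (γ i j * γ j k))              ≈⟨ *-congˡ (*-congʳ (E-chain i j k)) ⟨
      γ i k * ((E i j + u i j * E j k) * (γ i j * γ j k))   ≈⟨ *-congˡ (distribʳ _ _ _) ⟩
      γ i k * (E i j * (γ i j * γ j k) + u i j * E j k * (γ i j * γ j k))
        ≈⟨ *-congˡ (trans (+-comm _ _) (+-cong second first)) ⟩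
      γ i k * (u i j * γ i j + γ j k)                ∎
      where
      first : E i j * (γ i j * γ j k) ≈ γ j k
      first = trans (sym (*-assoc _ _ _)) (trans (*-congʳ (E*γ≈1 i≢j)) (*-identityˡ _))
      second : u i j * E j k * (γ i j * γ j k) ≈ u i j * γ i j
      second = begin
        u i j * E j k * (γ i j * γ j k)    ≈⟨ *-assoc _ _ _ ⟩
        u i j * (E j k * (γ i j * γ j k))  ≈⟨ *-congˡ (*-congˡ (γ-comm i j j k)) ⟩
        u i j * (E j k * (γ j k * γ i j))  ≈⟨ *-congˡ (*-assoc _ _ _) ⟨
        u i j * (E j k * γ j k * γ i j)    ≈⟨ *-congˡ (*-congʳ (E*γ≈1 j≢k)) ⟩
        u i j * (1# * γ i j)               ≈⟨ *-congˡ (*-identityˡ _) ⟩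
        u i j * γ i j                      ∎

    -- By `γ-product` both sides have the left factor γ i k, and the cofactors agree because 1 + u i
    -- j * γ i j = γ i j.
    γ-cocycle : ∀ i j k → i ≢ j → j ≢ k → i ≢ k →
                γ i k + γ i j * γ j k ≈ γ i j * γ i k + γ i k * γ j k
    γ-cocycle i j k i≢j j≢k i≢k = begin
      γ i k + γ i j * γ j k
        ≈⟨ +-cong (sym (*-identityʳ _)) (γ-product i j k i≢j j≢k i≢k) ⟩
      γ i k * 1# + γ i k * (u i j * γ i j + γ j k)         ≈⟨ distribˡ _ _ _ ⟨
      γ i k * (1# + (u i j * γ i j + γ j k))               ≈⟨ *-congˡ (+-assoc _ _ _) ⟨
      γ i k * (1# + u i j * γ i j + γ j k)
        ≈⟨ *-congˡ (+-congʳ (trans (γ≈1+γu i≢j) (+-congˡ (γ-u i j i j)))) ⟨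
      γ i k * (γ i j + γ j k)                              ≈⟨ distribˡ _ _ _ ⟩
      γ i k * γ i j + γ i k * γ j k                        ≈⟨ +-congʳ (γ-comm i k i j) ⟩
      γ i j * γ i k + γ i k * γ j k                        ∎

    -- Going from i to j and back gives E i j + u i j * E j i = E i i = 0, so E i j * γ j i is minus
    -- u i j and cancels the excess of γ i j over 1.
    γ-sum : ∀ i j → i ≢ j → γ i j + γ j i ≈ 1#
    γ-sum i j i≢j = begin
      γ i j + γ j i                          ≈⟨ +-comm _ _ ⟩
      γ j i + γ i j                          ≈⟨ +-congʳ (trans (sym (*-identityˡ _)) (*-congʳ (sym (γ*E≈1 i≢j)))) ⟩
      γ i j * E i j * γ j i + γ i j          ≈⟨ +-cong (*-assoc _ _ _) (γ≈1+γu i≢j) ⟩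
      γ i j * (E i j * γ j i) + (1# + γ i j * u i j)   ≈⟨ trans (+-congˡ (+-comm _ _)) (sym (+-assoc _ _ _)) ⟩
      γ i j * (E i j * γ j i) + γ i j * u i j + 1#     ≈⟨ +-congʳ (distribˡ _ _ _) ⟨
      γ i j * (E i j * γ j i + u i j) + 1#   ≈⟨ +-congʳ (trans (*-congˡ Eγ+u≈0) (zeroʳ _)) ⟩
      0# + 1#                                ≈⟨ +-identityˡ 1# ⟩
      1#                                     ∎
      where
      Eγ+u≈0 : E i j * γ j i + u i j ≈ 0#
      Eγ+u≈0 = begin
        E i j * γ j i + u i j
          ≈⟨ +-congˡ (trans (sym (*-identityʳ _)) (*-congˡ (sym (E*γ≈1 (i≢j ∘ ≡.sym))))) ⟩
        E i j * γ j i + u i j * (E j i * γ j i)      ≈⟨ +-congˡ (*-assoc _ _ _) ⟨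
        E i j * γ j i + u i j * E j i * γ j i        ≈⟨ distribʳ _ _ _ ⟨
        (E i j + u i j * E j i) * γ j i              ≈⟨ *-congʳ (trans (E-chain i j i) E-diagonal) ⟩
        0# * γ j i                                   ≈⟨ zeroˡ _ ⟩
        0#                                           ∎
        where
        E-diagonal : E i i ≈ 0#
        E-diagonal = trans (+-congˡ (-‿cong (W*W⁻¹≈1 i))) (-‿inverseʳ 1#)

    -- This is (1 - W i / W j) W j = W j - W i divided by 1 - W i / W j. It is the source of the
    -- correction term that matches the Bernstein relations below.
    γW-exchange : ∀ i j → i ≢ j → γ i j * W j ≈ γ i j * W i + W j
    γW-exchange i j i≢j = begin
      γ i j * W j                              ≈⟨ *-congʳ (γ≈1+γu i≢j) ⟩
      (1# + γ i j * u i j) * W j               ≈⟨ distribʳ _ _ _ ⟩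
      1# * W j + γ i j * u i j * W j           ≈⟨ +-cong (*-identityˡ _) (trans (*-assoc _ _ _) (*-congˡ uW≈W)) ⟩
      W j + γ i j * W i                        ≈⟨ +-comm _ _ ⟩
      γ i j * W i + W j                        ∎
      where
      uW≈W : u i j * W j ≈ W i
      uW≈W = trans (*-assoc _ _ _) (trans (*-congˡ (W⁻¹*W≈1 j)) (*-identityʳ _))

    -- Since u γ = γ - 1, the fraction (b - a u) γ i j equals b γ i j + a (1 - γ i j), and 1 - γ i j
    -- = γ j i. The numerator enters through N + a u = b, free of subtraction.
    c-formula : ∀ {a b N x} → Central a → Central b → ∀ {i j} → i ≢ j →
                N + a * u i j ≈ b → x * E i j ≈ 1# → N * x ≈ a * γ j i + b * γ i j
    c-formula {a} {b} {N} {x} a-central b-central {i} {j} i≢j N+au≈b xE≈1 = +-cancelʳ (a * γ i j) _ _ (begin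
      N * x + a * γ i j                          ≈⟨ +-cong (*-congˡ (γ-unique i≢j xE≈1)) (*-congˡ (γ≈1+γu i≢j)) ⟩
      N * γ i j + a * (1# + γ i j * u i j)       ≈⟨ +-congˡ (trans (*-congˡ (+-comm _ _)) (distribˡ a _ _)) ⟩
      N * γ i j + (a * (γ i j * u i j) + a * 1#) ≈⟨ +-assoc _ _ _ ⟨
      N * γ i j + a * (γ i j * u i j) + a * 1#
        ≈⟨ +-cong (+-congˡ (trans (*-congˡ (γ-u i j i j)) (sym (*-assoc a _ _)))) (*-congˡ (sym (γ-sum i j i≢j))) ⟩
      N * γ i j + a * u i j * γ i j + a * (γ i j + γ j i)
        ≈⟨ +-cong (trans (sym (distribʳ _ _ _)) (*-congʳ N+au≈b)) (distribˡ a _ _) ⟩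
      b * γ i j + (a * γ i j + a * γ j i)        ≈⟨ +-congˡ (+-comm _ _) ⟩
      b * γ i j + (a * γ j i + a * γ i j)        ≈⟨ +-assoc _ _ _ ⟨
      b * γ i j + a * γ j i + a * γ i j          ≈⟨ +-congʳ (+-comm _ _) ⟩
      a * γ j i + b * γ i j + a * γ i j          ∎)

    module _
      (braid : ∀ i j → toℕ j ≡ suc (toℕ i) → T i * T j * T i ≈ T j * T i * T j)
      (far : ∀ i j → 1 ℕ.< ∣ toℕ i - toℕ j ∣ → T i * T j ≈ T j * T i)
      (quadratic : ∀ i → T i * T i ≈ q * T i + 1#)
      (T-W : ∀ i j → j ≢ inject₁ i → j ≢ suc i → T i * W j ≈ W j * T i)
      (TWT≈W : ∀ i → T i * W (inject₁ i) * T i ≈ W (suc i))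
      where

      private
        τ : Fin m → Carrier
        τ i = T i - q * γ (inject₁ i) (suc i)

        τ+qγ≈T : ∀ i → τ i + q * γ (inject₁ i) (suc i) ≈ T i
        τ+qγ≈T i = trans (+-assoc _ _ _) (trans (+-congˡ (-‿inverseˡ _)) (+-identityʳ _))

      -- Bernstein relations: multiply T W T = W′ by one more T, here on the right and in the next
      -- lemma on the left, and reduce T² by the quadratic relation.
      W′T≈TW+qW′ : ∀ i → W (suc i) * T i ≈ T i * W (inject₁ i) + q * W (suc i)
      W′T≈TW+qW′ i = begin
        W (suc i) * T i                                          ≈⟨ *-congʳ (TWT≈W i) ⟨
        T i * W (inject₁ i) * T i * T i                          ≈⟨ *-assoc _ _ _ ⟩
        T i * W (inject₁ i) * (T i * T i)                        ≈⟨ *-congˡ (quadratic i) ⟩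
        T i * W (inject₁ i) * (q * T i + 1#)                     ≈⟨ distribˡ _ _ _ ⟩
        T i * W (inject₁ i) * (q * T i) + T i * W (inject₁ i) * 1#
          ≈⟨ +-cong (central-swap q-central _ _) (*-identityʳ _) ⟩
        q * (T i * W (inject₁ i) * T i) + T i * W (inject₁ i)    ≈⟨ +-congʳ (*-congˡ (TWT≈W i)) ⟩
        q * W (suc i) + T i * W (inject₁ i)                      ≈⟨ +-comm _ _ ⟩
        T i * W (inject₁ i) + q * W (suc i)                      ∎

      TW′≈WT+qW′ : ∀ i → T i * W (suc i) ≈ W (inject₁ i) * T i + q * W (suc i)
      TW′≈WT+qW′ i = begin
        T i * W (suc i)
          ≈⟨ *-congˡ (trans (sym (*-assoc _ _ _)) (TWT≈W i)) ⟨
        T i * (T i * (W (inject₁ i) * T i))                      ≈⟨ *-assoc _ _ _ ⟨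
        T i * T i * (W (inject₁ i) * T i)                        ≈⟨ *-congʳ (quadratic i) ⟩
        (q * T i + 1#) * (W (inject₁ i) * T i)                   ≈⟨ distribʳ _ _ _ ⟩
        q * T i * (W (inject₁ i) * T i) + 1# * (W (inject₁ i) * T i)  ≈⟨ +-cong (*-assoc _ _ _) (*-identityˡ _) ⟩
        q * (T i * (W (inject₁ i) * T i)) + W (inject₁ i) * T i
          ≈⟨ +-congʳ (*-congˡ (trans (sym (*-assoc _ _ _)) (TWT≈W i))) ⟩
        q * W (suc i) + W (inject₁ i) * T i                      ≈⟨ +-comm _ _ ⟩
        W (inject₁ i) * T i + q * W (suc i)                      ∎

      private
        qγW-exchange : ∀ i → q * γ (inject₁ i) (suc i) * W (suc i) ≈
                             q * γ (inject₁ i) (suc i) * W (inject₁ i) + q * W (suc i)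
        qγW-exchange i = begin
          q * γ (inject₁ i) (suc i) * W (suc i)      ≈⟨ *-assoc q _ _ ⟩
          q * (γ (inject₁ i) (suc i) * W (suc i))    ≈⟨ *-congˡ (γW-exchange _ _ (inject₁≢suc i)) ⟩
          q * (γ (inject₁ i) (suc i) * W (inject₁ i) + W (suc i))  ≈⟨ distribˡ q _ _ ⟩
          q * (γ (inject₁ i) (suc i) * W (inject₁ i)) + q * W (suc i)  ≈⟨ +-congʳ (*-assoc q _ _) ⟨
          q * γ (inject₁ i) (suc i) * W (inject₁ i) + q * W (suc i)  ∎

        W-qγ : ∀ i j → W j * (q * γ (inject₁ i) (suc i)) ≈ q * γ (inject₁ i) (suc i) * W j
        W-qγ i j = intertwines-* (sym (q-central _)) (sym (γ-W (inject₁ i) (suc i) j))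

      private
        -- Subtracting G from T removes the correction term of the Bernstein relation: by
        -- `qγW-exchange` the products of G with the two variables differ by exactly q W_{i+1}.
        τ-W₀ : ∀ i → τ i * W (inject₁ i) ≈ W (suc i) * τ i
        τ-W₀ i = +-cancelʳ (G * W (suc i)) _ _ (begin
          τ i * W (inject₁ i) + G * W (suc i)                              ≈⟨ +-congˡ (qγW-exchange i) ⟩
          τ i * W (inject₁ i) + (G * W (inject₁ i) + q * W (suc i))        ≈⟨ +-assoc _ _ _ ⟨
          τ i * W (inject₁ i) + G * W (inject₁ i) + q * W (suc i)
            ≈⟨ +-congʳ (trans (sym (distribʳ _ _ _)) (*-congʳ (τ+qγ≈T i))) ⟩
          T i * W (inject₁ i) + q * W (suc i)                              ≈⟨ W′T≈TW+qW′ i ⟨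
          W (suc i) * T i                                                  ≈⟨ *-congˡ (τ+qγ≈T i) ⟨
          W (suc i) * (τ i + G)                                            ≈⟨ distribˡ _ _ _ ⟩
          W (suc i) * τ i + W (suc i) * G                                  ≈⟨ +-congˡ (W-qγ i _) ⟩
          W (suc i) * τ i + G * W (suc i)                                  ∎)
          where G = q * γ (inject₁ i) (suc i)

        τ-W₁ : ∀ i → τ i * W (suc i) ≈ W (inject₁ i) * τ i
        τ-W₁ i = +-cancelʳ (G * W (suc i)) _ _ (begin
          τ i * W (suc i) + G * W (suc i)
            ≈⟨ trans (sym (distribʳ _ _ _)) (*-congʳ (τ+qγ≈T i)) ⟩
          T i * W (suc i)                                                  ≈⟨ TW′≈WT+qW′ i ⟩
          W (inject₁ i) * T i + q * W (suc i)                              ≈⟨ +-congʳ (*-congˡ (τ+qγ≈T i)) ⟨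
          W (inject₁ i) * (τ i + G) + q * W (suc i)
            ≈⟨ +-congʳ (trans (distribˡ _ _ _) (+-congˡ (W-qγ i _))) ⟩
          W (inject₁ i) * τ i + G * W (inject₁ i) + q * W (suc i)          ≈⟨ +-assoc _ _ _ ⟩
          W (inject₁ i) * τ i + (G * W (inject₁ i) + q * W (suc i))        ≈⟨ +-congˡ (qγW-exchange i) ⟨
          W (inject₁ i) * τ i + G * W (suc i)                              ∎)
          where G = q * γ (inject₁ i) (suc i)

        τ-W-other : ∀ i j → j ≢ inject₁ i → j ≢ suc i → τ i * W j ≈ W j * τ i
        τ-W-other i j j≢i j≢i+1 = +-cancelʳ (G * W j) _ _ (begin
          τ i * W j + G * W j        ≈⟨ trans (sym (distribʳ _ _ _)) (*-congʳ (τ+qγ≈T i)) ⟩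
          T i * W j                  ≈⟨ T-W i j j≢i j≢i+1 ⟩
          W j * T i                  ≈⟨ *-congˡ (τ+qγ≈T i) ⟨
          W j * (τ i + G)            ≈⟨ distribˡ _ _ _ ⟩
          W j * τ i + W j * G        ≈⟨ +-congˡ (W-qγ i _) ⟩
          W j * τ i + G * W j        ∎)
          where G = q * γ (inject₁ i) (suc i)

      τ-W : ∀ i j → τ i * W j ≈ W (s i ⟨$⟩ʳ j) * τ i
      τ-W i j = by-cases (j Fin.≟ inject₁ i) (j Fin.≟ suc i)
        where
        by-cases : Dec (j ≡ inject₁ i) → Dec (j ≡ suc i) → τ i * W j ≈ W (s i ⟨$⟩ʳ j) * τ i
        by-cases (yes ≡.refl) _            = trans (τ-W₀ i) (*-congʳ (reflexive (≡.cong W (≡.sym (s-inject₁ i)))))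
        by-cases (no _)       (yes ≡.refl) = trans (τ-W₁ i) (*-congʳ (reflexive (≡.cong W (≡.sym (s-suc≡inject₁ i)))))
        by-cases (no j≢i)     (no j≢i+1)   =
          trans (τ-W-other i j j≢i j≢i+1) (*-congʳ (reflexive (≡.cong W (≡.sym (s-other i j j≢i j≢i+1)))))

      laurentFamily : HeckeFamily T γ
      laurentFamily = record
        { braid       = braid
        ; far         = far
        ; quadratic   = quadratic
        ; γ-comm      = γ-comm
        ; γ-sum       = γ-sum
        ; γ-cocycle   = γ-cocycle
        ; intertwines = λ i → intertwines-γ {π = s i ⟨$⟩ʳ_} (τ-W i) (Injection.injective (↔⇒↣ (s i)))
        }

-- Centrality in presented rings and monomials as products

module PresentedProperties {g r} {G : Set g} (R : Rel (Expr G) r) where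

  open Ring (Presented.ring R) hiding (zero)
  open RingProducts (Presented.ring R)
  open RingProperties (Presented.ring R) using (-‿distribˡ-*; -‿distribʳ-*)

  central-on-generators : ∀ {z} → (∀ x → z * gen x ≈ gen x * z) → Central z
  central-on-generators zg≈gz (gen x) = zg≈gz x
  central-on-generators {z} zg≈gz 𝟘   = trans (zeroʳ z) (sym (zeroˡ z))
  central-on-generators {z} zg≈gz 𝟙   = sym (1-central z)
  central-on-generators zg≈gz (x ⊕ y) =
    intertwines-+ (central-on-generators zg≈gz x) (central-on-generators zg≈gz y)
  central-on-generators zg≈gz (x ⊛ y) =
    intertwines-* (central-on-generators zg≈gz x) (central-on-generators zg≈gz y)
  central-on-generators {z} zg≈gz (⊖ x) = trans (sym (-‿distribʳ-* z x))
    (trans (-‿cong (central-on-generators zg≈gz x)) (-‿distribˡ-* x z))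

module KroneckerProducts {e ℓ} (A : Ring e ℓ) where

  open Ring A hiding (zero)
  open RingProducts A
  open SetoidReasoning setoid

  ∏-1 : ∀ {n} {f : Fin n → Carrier} → (∀ i → f i ≈ 1#) → ∏ f ≈ 1#
  ∏-1 {zero}  f≈1 = refl
  ∏-1 {suc n} f≈1 = trans (*-cong (f≈1 zero) (∏-1 (f≈1 ∘ suc))) (*-identityˡ 1#)

  -- Evaluating an exponent vector multiplies over all variables; z_i / z_j then appears as the
  -- entrywise product of two such sequences, one for each nonzero exponent.
  pick : ∀ {n} → Fin n → Carrier → Fin n → Carrier
  pick i x k = if does (k Fin.≟ i) then x else 1#

  ∏-pick : ∀ {n} (i : Fin n) x → ∏ (pick i x) ≈ x
  ∏-pick {suc n} zero x = trans (*-congˡ (∏-1 {n} {λ k → pick zero x (suc k)} λ _ → refl)) (*-identityʳ x)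
  ∏-pick {suc n} (suc i) x = trans (*-identityˡ _) (∏-pick i x)

  pick-comm : ∀ {n} {i j : Fin n} {x y} → x * y ≈ y * x → ∀ k l → pick i x k * pick j y l ≈ pick j y l * pick i x k
  pick-comm {i = i} {j} {x} {y} xy≈yx k l with does (k Fin.≟ i) | does (l Fin.≟ j)
  ... | true  | true  = xy≈yx
  ... | true  | false = sym (1-central x)
  ... | false | _                    = 1-central _

  ∏-* : ∀ {n} {f g : Fin n → Carrier} → (∀ i j → f i * g j ≈ g j * f i) → ∏ (λ i → f i * g i) ≈ ∏ f * ∏ g
  ∏-* {zero}  fg≈gf = sym (*-identityˡ 1#)
  ∏-* {suc n} {f} {g} fg≈gf = begin
    f₀ * g₀ * ∏ (λ i → f (suc i) * g (suc i))   ≈⟨ *-congˡ (∏-* (λ i j → fg≈gf (suc i) (suc j))) ⟩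
    f₀ * g₀ * (F * G)                           ≈⟨ *-assoc f₀ g₀ _ ⟩
    f₀ * (g₀ * (F * G))                         ≈⟨ *-congˡ (*-assoc g₀ F G) ⟨
    f₀ * (g₀ * F * G)
      ≈⟨ *-congˡ (*-congʳ (intertwines-∏ (λ i → sym (fg≈gf (suc i) zero)))) ⟩
    f₀ * (F * g₀ * G)                           ≈⟨ *-congˡ (*-assoc F g₀ G) ⟩
    f₀ * (F * (g₀ * G))                         ≈⟨ *-assoc f₀ F _ ⟨
    f₀ * F * (g₀ * G)                           ∎
    where
    f₀ = f zero
    g₀ = g zero
    F  = ∏ (f ∘ suc)
    G  = ∏ (g ∘ suc)

-- Both factorizations in terms of numerators and denominators

module LocalizedFactorizations {e ℓ} (A : Ring e ℓ) (q : Ring.Carrier A) (q-central : RingProducts.Central A q)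
  (a b : Ring.Carrier A) (a-central : RingProducts.Central A a) (b-central : RingProducts.Central A b)
  (a≈b+q : Ring._≈_ A a (Ring._+_ A b q)) (ab≈1 : Ring._≈_ A (Ring._*_ A a b) (Ring.1# A)) where

  open Ring A hiding (zero)
  open RingProducts A
  open WeightedSums A
  open RingProperties A using (+-cancelʳ)
  open HeckeFamilies A q q-central using (HeckeFamily; module HeckeFamily)
  open SetoidReasoning setoid

  -- W stands for X or Y⁻¹; N i j and D i j are the numerator and denominator of c_ij.
  record Coordinates {m} (T : Fin m → Carrier) : Set (e Level.⊔ ℓ) where
    field
      braid     : ∀ i j → toℕ j ≡ suc (toℕ i) → T i * T j * T i ≈ T j * T i * T j
      far       : ∀ i j → 1 ℕ.< ∣ toℕ i - toℕ j ∣ → T i * T j ≈ T j * T i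
      quadratic : ∀ i → T i * T i ≈ q * T i + 1#
      W W⁻¹     : Fin (suc m) → Carrier
      W-comm    : ∀ i j → W i * W j ≈ W j * W i
      W*W⁻¹≈1   : ∀ i → W i * W⁻¹ i ≈ 1#
      W⁻¹*W≈1   : ∀ i → W⁻¹ i * W i ≈ 1#
      T-W       : ∀ i j → j ≢ inject₁ i → j ≢ suc i → T i * W j ≈ W j * T i
      TWT≈W     : ∀ i → T i * W (inject₁ i) * T i ≈ W (suc i)
      N N⁻¹     : ∀ i j → i ≢ j → Carrier
      D D⁻¹     : ∀ i j → i ≢ j → Carrier
      N-def     : ∀ i j i≢j → N i j i≢j ≈ b - a * (W i * W⁻¹ j)
      D-def     : ∀ i j i≢j → D i j i≢j ≈ 1# - W i * W⁻¹ j
      N*N⁻¹≈1   : ∀ i j i≢j → N i j i≢j * N⁻¹ i j i≢j ≈ 1#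
      N⁻¹*N≈1   : ∀ i j i≢j → N⁻¹ i j i≢j * N i j i≢j ≈ 1#
      D*D⁻¹≈1   : ∀ i j i≢j → D i j i≢j * D⁻¹ i j i≢j ≈ 1#
      D⁻¹*D≈1   : ∀ i j i≢j → D⁻¹ i j i≢j * D i j i≢j ≈ 1#

    c c⁻¹ : ∀ i j → i ≢ j → Carrier
    c   i j i≢j = N i j i≢j * D⁻¹ i j i≢j
    c⁻¹ i j i≢j = D i j i≢j * N⁻¹ i j i≢j

    ξ : Fin m → Carrier
    ξ i = c⁻¹ (inject₁ i) (suc i) (inject₁≢suc i) * (T i + b - c (suc i) (inject₁ i) (inject₁≢suc i ∘ ≡.sym))

  module Factorization {m} {T : Fin m → Carrier} (coordinates : Coordinates T) where

    open Coordinates coordinates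
    open LaurentFamilies A q q-central
    open Variables T W W⁻¹ W-comm W*W⁻¹≈1 W⁻¹*W≈1 D⁻¹
      (λ i j i≢j → trans (*-congˡ (sym (D-def i j i≢j))) (D⁻¹*D≈1 i j i≢j))
      (λ i j i≢j → trans (*-congʳ (sym (D-def i j i≢j))) (D*D⁻¹≈1 i j i≢j))

    private
      family : HeckeFamily T γ
      family = laurentFamily braid far quadratic T-W TWT≈W

    open HeckeFamily family using (τ; T≈τ+qγ)

    ĉ : Fin (suc m) → Fin (suc m) → Carrier
    ĉ i j = a * γ j i + b * γ i j

    c≈ĉ : ∀ i j i≢j → c i j i≢j ≈ ĉ i j
    c≈ĉ i j i≢j = c-formula a-central b-central i≢j
      (begin
        N i j i≢j + a * u i j          ≈⟨ +-congʳ (N-def i j i≢j) ⟩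
        b - a * u i j + a * u i j      ≈⟨ +-assoc _ _ _ ⟩
        b + (- (a * u i j) + a * u i j)  ≈⟨ +-congˡ (-‿inverseˡ _) ⟩
        b + 0#                         ≈⟨ +-identityʳ b ⟩
        b                              ∎)
      (trans (*-congˡ (sym (D-def i j i≢j))) (D⁻¹*D≈1 i j i≢j))

    quotient-inverse : ∀ {x x⁻¹ y y⁻¹} → x * x⁻¹ ≈ 1# → y⁻¹ * y ≈ 1# → x * y⁻¹ * (y * x⁻¹) ≈ 1#
    quotient-inverse {x} {x⁻¹} {y} {y⁻¹} xx⁻¹≈1 y⁻¹y≈1 = begin
      x * y⁻¹ * (y * x⁻¹)      ≈⟨ *-assoc x y⁻¹ _ ⟩
      x * (y⁻¹ * (y * x⁻¹))    ≈⟨ *-congˡ (*-assoc y⁻¹ y x⁻¹) ⟨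
      x * (y⁻¹ * y * x⁻¹)      ≈⟨ *-congˡ (*-congʳ y⁻¹y≈1) ⟩
      x * (1# * x⁻¹)           ≈⟨ *-congˡ (*-identityˡ x⁻¹) ⟩
      x * x⁻¹                  ≈⟨ xx⁻¹≈1 ⟩
      1#                       ∎

    ĉ*c⁻¹≈1 : ∀ i j i≢j → ĉ i j * c⁻¹ i j i≢j ≈ 1#
    ĉ*c⁻¹≈1 i j i≢j = trans (*-congʳ (sym (c≈ĉ i j i≢j)))
      (quotient-inverse (N*N⁻¹≈1 i j i≢j) (D⁻¹*D≈1 i j i≢j))

    c⁻¹*ĉ≈1 : ∀ i j i≢j → c⁻¹ i j i≢j * ĉ i j ≈ 1#
    c⁻¹*ĉ≈1 i j i≢j = trans (*-congˡ (sym (c≈ĉ i j i≢j)))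
      (quotient-inverse (D*D⁻¹≈1 i j i≢j) (N⁻¹*N≈1 i j i≢j))

    suc≢inject₁ : ∀ (i : Fin m) → suc i ≢ inject₁ i
    suc≢inject₁ i = inject₁≢suc i ∘ ≡.sym

    -- From γ₀₁ + γ₁₀ = 1 and a = b + q one gets c_{i+1,i} = b + q γ₀₁; subtracting this from T_i +
    -- b leaves T_i - q γ₀₁ = τ_i.
    ξ≈c⁻¹τ : ∀ i → ξ i ≈ c⁻¹ (inject₁ i) (suc i) (inject₁≢suc i) * τ i
    ξ≈c⁻¹τ i = *-congˡ (+-cancelʳ (ĉ (suc i) (inject₁ i)) _ _ (begin
      T i + b - c _ _ _ + ĉ (suc i) (inject₁ i)    ≈⟨ +-congʳ (+-congˡ (-‿cong (c≈ĉ _ _ (suc≢inject₁ i)))) ⟩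
      T i + b - ĉ (suc i) (inject₁ i) + ĉ (suc i) (inject₁ i)
        ≈⟨ trans (+-assoc _ _ _) (trans (+-congˡ (-‿inverseˡ _)) (+-identityʳ _)) ⟩
      T i + b
        ≈⟨ +-cong (T≈τ+qγ i) (trans (sym (*-identityʳ b)) (*-congˡ (sym (γ-sum _ _ (inject₁≢suc i))))) ⟩
      τ i + q * γ₀₁ + b * (γ₀₁ + γ₁₀)           ≈⟨ +-congˡ (distribˡ b _ _) ⟩
      τ i + q * γ₀₁ + (b * γ₀₁ + b * γ₁₀)       ≈⟨ +-assoc _ _ _ ⟩
      τ i + (q * γ₀₁ + (b * γ₀₁ + b * γ₁₀))     ≈⟨ +-congˡ (+-assoc _ _ _) ⟨
      τ i + (q * γ₀₁ + b * γ₀₁ + b * γ₁₀)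
        ≈⟨ +-congˡ (+-congʳ (trans (sym (distribʳ _ q b)) (*-congʳ (trans (+-comm q b) (sym a≈b+q))))) ⟩
      τ i + ĉ (suc i) (inject₁ i)               ∎))
      where
      γ₀₁ = γ (inject₁ i) (suc i)
      γ₁₀ = γ (suc i) (inject₁ i)

    open HeckeFamilies.Parameters A q q-central a b a-central b-central a≈b+q ab≈1

    weighted-b-factors : weighted b T ≈ weighted 1# ξ * ∏< (λ i j → ĉ j i)
    weighted-b-factors = symmetrizer-factors family
      (λ i → ĉ*c⁻¹≈1 _ _ (inject₁≢suc i)) (λ i → c⁻¹*ĉ≈1 _ _ (inject₁≢suc i)) ξ≈c⁻¹τ

    weighted-a-factors : weighted (- a) T ≈ ∏< ĉ * weighted (- 1#) ξ
    weighted-a-factors = antisymmetrizer-factors family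
      (λ i → ĉ*c⁻¹≈1 _ _ (inject₁≢suc i)) (λ i → c⁻¹*ĉ≈1 _ _ (inject₁≢suc i))
      (λ i → ĉ*c⁻¹≈1 _ _ (suc≢inject₁ i)) (λ i → c⁻¹*ĉ≈1 _ _ (suc≢inject₁ i)) ξ≈c⁻¹τ

-- The affine Hecke algebras and their localizations

module HeckeAlgebra {ℓ₀ ℓ₁ ℓ₂} (K : HeytingField ℓ₀ ℓ₁ ℓ₂)
  (t½ : HeytingField.Carrier K) (t½#0 : HeytingField._#_ K t½ (HeytingField.0# K)) (m : ℕ) where

  open AffineHecke K t½ t½#0 m hiding (H)
  open Powers (Semiring.rawSemiring Kᶜ.semiring) using () renaming (_^_ to _^ᴷ_)

  -- The exponent is at most 0, so `zpow` takes the branch of the inverse, except at 0, where both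
  -- powers are 1.
  zpow-ℓ : ∀ u u⁻¹ {l N} → l ℕ.≤ N → zpow u u⁻¹ (+ l ℤ.- + N) ≡ u⁻¹ ^ᴷ (N ∸ l)
  zpow-ℓ u u⁻¹ {l} {N} l≤N =
    ≡.trans (≡.cong (zpow u u⁻¹) (≡.trans (ℤ.m-n≡m⊖n l N) (ℤ.⊖-≤ l≤N))) (nonpositive (N ∸ l))
    where
    nonpositive : ∀ k → zpow u u⁻¹ (ℤ.- + k) ≡ u⁻¹ ^ᴷ k
    nonpositive zero    = ≡.refl
    nonpositive (suc k) = ≡.refl

  module Polynomials (v : Side) where

    H : Ring ℓ₀ (ℓ₀ Level.⊔ ℓ₁)
    H = AffineHecke.H K t½ t½#0 m v

    open Ring H hiding (zero)
    open RingProducts H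
    open RingProperties H using (x+x≈x⇒x≈0; +-cancelʳ)
    open KroneckerProducts H
    open PresentedProperties (HeckeRelation v)
    open Presented (HeckeRelation v) using (relation)
    open SetoidReasoning setoid

    scalarᴴ : K.Carrier → Carrier
    scalarᴴ x = gen (scalar x)

    scalarᴴ-central : ∀ x → Central (scalarᴴ x)
    scalarᴴ-central x = central-on-generators (λ g → relation (scalar-central x g))

    -- The relation for sums makes the image of 0 additively idempotent, hence zero.
    scalarᴴ-0 : scalarᴴ K.0# ≈ 0#
    scalarᴴ-0 = x+x≈x⇒x≈0 _ (trans (sym (relation (scalar-+ K.0# K.0#))) (relation (scalar-cong (K.+-identityˡ K.0#))))

    -scalarᴴ : ∀ x → scalarᴴ (K.- x) ≈ - scalarᴴ x
    -scalarᴴ x = +-cancelʳ (scalarᴴ x) _ _ (begin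
      scalarᴴ (K.- x) + scalarᴴ x   ≈⟨ relation (scalar-+ (K.- x) x) ⟨
      scalarᴴ (K.- x K.+ x)         ≈⟨ relation (scalar-cong (K.-‿inverseˡ x)) ⟩
      scalarᴴ K.0#                  ≈⟨ scalarᴴ-0 ⟩
      0#                            ≈⟨ -‿inverseˡ _ ⟨
      - scalarᴴ x + scalarᴴ x       ∎)

    Z-Z⁻¹ : ∀ i j → gen (Z i) * gen (Z⁻¹ j) ≈ gen (Z⁻¹ j) * gen (Z i)
    Z-Z⁻¹ i j = intertwines-inverse (relation (Z-invʳ j)) (relation (Z-invˡ j)) (relation (Z-comm i j))

    Z⁻¹-comm : ∀ i j → gen (Z⁻¹ i) * gen (Z⁻¹ j) ≈ gen (Z⁻¹ j) * gen (Z⁻¹ i)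
    Z⁻¹-comm i j = intertwines-inverse (relation (Z-invʳ j)) (relation (Z-invˡ j)) (sym (Z-Z⁻¹ j i))

    monomial : Exponent → Carrier
    monomial e = product (map (λ i → power i (lookup e i)) (allFin (suc m)))

    monomial-1 : monomial (replicate (suc m) (+ 0)) ≈ 1#
    monomial-1 = trans (∏-allFin (λ i → power i (lookup (replicate (suc m) (+ 0)) i)))
      (∏-1 λ i → reflexive (≡.cong (power i) (Vec.lookup-replicate i (+ 0))))

    monomial-δ-δ : ∀ i j → i ≢ j → monomial (δ-δ i j) ≈ gen (Z i) * gen (Z⁻¹ j)
    monomial-δ-δ i j i≢j = begin
      monomial (δ-δ i j)                                  ≈⟨ ∏-allFin (λ k → power k (lookup (δ-δ i j) k)) ⟩
      ∏ (λ k → power k (lookup (δ-δ i j) k))              ≈⟨ ∏-cong factor ⟩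
      ∏ (λ k → pick i (gen (Z i)) k * pick j (gen (Z⁻¹ j)) k)
        ≈⟨ ∏-* {f = pick i (gen (Z i))} {g = pick j (gen (Z⁻¹ j))} (pick-comm (Z-Z⁻¹ i j)) ⟩
      ∏ (pick i (gen (Z i))) * ∏ (pick j (gen (Z⁻¹ j)))   ≈⟨ *-cong (∏-pick i _) (∏-pick j _) ⟩
      gen (Z i) * gen (Z⁻¹ j)                             ∎
      where
      factor : ∀ k → power k (lookup (δ-δ i j) k) ≈ pick i (gen (Z i)) k * pick j (gen (Z⁻¹ j)) k
      factor k
        rewrite Vec.lookup-zipWith ℤ._-_ k (δ i) (δ j)
              | Vec.lookup∘tabulate (λ k → if does (k Fin.≟ i) then + 1 else + 0) k
              | Vec.lookup∘tabulate (λ k → if does (k Fin.≟ j) then + 1 else + 0) k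
        with k Fin.≟ i | k Fin.≟ j
      ... | yes ≡.refl | yes ≡.refl = contradiction ≡.refl i≢j
      ... | yes ≡.refl | no _       = refl
      ... | no _       | yes ≡.refl = trans (*-identityʳ _) (sym (*-identityˡ _))
      ... | no _       | no _       = sym (*-identityˡ 1#)

    evaluate-binomial : ∀ x y i j → i ≢ j →
                        evaluate (binomial x y i j) ≈ scalarᴴ x + - (scalarᴴ y * (gen (Z i) * gen (Z⁻¹ j)))
    evaluate-binomial x y i j i≢j = +-cong
      (trans (*-congˡ monomial-1) (*-identityʳ _))
      (begin
        scalarᴴ (K.- y) * monomial (δ-δ i j) + 0#       ≈⟨ +-identityʳ _ ⟩
        scalarᴴ (K.- y) * monomial (δ-δ i j)            ≈⟨ *-cong (-scalarᴴ y) (monomial-δ-δ i j i≢j) ⟩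
        - scalarᴴ y * (gen (Z i) * gen (Z⁻¹ j))         ≈⟨ -‿distribˡ-* _ _ ⟨
        - (scalarᴴ y * (gen (Z i) * gen (Z⁻¹ j)))       ∎)
      where open RingProperties H using (-‿distribˡ-*)

  module LocalizedAlgebra (v : Side) where

    open Polynomials v using (H; scalarᴴ-central; -scalarᴴ; evaluate-binomial; Z-Z⁻¹)
    module H = Ring H using (Carrier; _≈_; _+_; _*_; -_; 0#; 1#; -‿inverseˡ; +-identityˡ)
    open Localized v
    open Ring Ĥ using (Carrier; _≈_; _+_; _*_; -_; _-_; 0#; 1#; refl; sym; trans; reflexive; setoid; +-cong; +-congˡ;
      -‿cong; -‿inverseˡ; *-cong; *-congˡ; *-congʳ; *-identityˡ)
    open RingProducts Ĥ using (Central; product; _^_; ^-congˡ; 1^n≈1; intertwines-inverse; sum-cong;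
      ∏_; ∏<; ∏-cong; ∏-allFin; ∏∏≈∏<)
    open WeightedSums Ĥ using (weighted)
    open RingProperties Ĥ using (x+x≈x⇒x≈0; +-cancelʳ)
    open PresentedProperties Relation̂ using (central-on-generators)
    open Presented Relation̂ using (relation)
    open SetoidReasoning setoid

    ι̂ : H.Carrier → Carrier
    ι̂ x = gen (ι x)

    ι̂-cong : ∀ {x y} → x H.≈ y → ι̂ x ≈ ι̂ y
    ι̂-cong x≈y = relation (Relation̂.ι-cong x≈y)

    ι̂-+ : ∀ x y → ι̂ (x H.+ y) ≈ ι̂ x + ι̂ y
    ι̂-+ x y = relation (Relation̂.ι-+ x y)

    ι̂-* : ∀ x y → ι̂ (x H.* y) ≈ ι̂ x * ι̂ y
    ι̂-* x y = relation (Relation̂.ι-* x y)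

    ι̂-1 : ι̂ H.1# ≈ 1#
    ι̂-1 = relation Relation̂.ι-1

    -ι̂ : ∀ x → ι̂ (H.- x) ≈ - ι̂ x
    -ι̂ x = +-cancelʳ (ι̂ x) _ _ (begin
      ι̂ (H.- x) + ι̂ x     ≈⟨ ι̂-+ (H.- x) x ⟨
      ι̂ (H.- x H.+ x)     ≈⟨ ι̂-cong (H.-‿inverseˡ x) ⟩
      ι̂ H.0#              ≈⟨ x+x≈x⇒x≈0 _ (trans (sym (ι̂-+ H.0# H.0#)) (ι̂-cong (H.+-identityˡ H.0#))) ⟩
      0#                  ≈⟨ -‿inverseˡ _ ⟨
      - ι̂ x + ι̂ x         ∎)

    ι̂-exchange : ∀ {x y x′ y′} → x H.* y H.≈ y′ H.* x′ → ι̂ x * ι̂ y ≈ ι̂ y′ * ι̂ x′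
    ι̂-exchange xy≈y′x′ = trans (sym (ι̂-* _ _)) (trans (ι̂-cong xy≈y′x′) (ι̂-* _ _))

    ι̂-inverse : ∀ {x y} → x H.* y H.≈ H.1# → ι̂ x * ι̂ y ≈ 1#
    ι̂-inverse xy≈1 = trans (sym (ι̂-* _ _)) (trans (ι̂-cong xy≈1) ι̂-1)

    scalar̂-central : ∀ x → Central (scalar̂ x)
    scalar̂-central x = central-on-generators λ
      { (ι y)   → ι̂-exchange (scalarᴴ-central x y)
      ; (inv k) → intertwines-inverse (relation (Relation̂.invʳ k)) (relation (Relation̂.invˡ k))
                    (ι̂-exchange (scalarᴴ-central x (evaluate (proj₁ k))))
      }

    scalar̂-cong : ∀ {x y} → x K.≈ y → scalar̂ x ≈ scalar̂ y
    scalar̂-cong x≈y = ι̂-cong (Presented.relation (scalar-cong x≈y))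

    scalar̂-+ : ∀ x y → scalar̂ (x K.+ y) ≈ scalar̂ x + scalar̂ y
    scalar̂-+ x y = trans (ι̂-cong (Presented.relation (scalar-+ x y))) (ι̂-+ _ _)

    scalar̂-* : ∀ x y → scalar̂ (x K.* y) ≈ scalar̂ x * scalar̂ y
    scalar̂-* x y = trans (ι̂-cong (Presented.relation (scalar-* x y))) (ι̂-* _ _)

    scalar̂-1 : scalar̂ K.1# ≈ 1#
    scalar̂-1 = trans (ι̂-cong (Presented.relation scalar-1)) ι̂-1

    -scalar̂ : ∀ x → scalar̂ (K.- x) ≈ - scalar̂ x
    -scalar̂ x = trans (ι̂-cong (-scalarᴴ x)) (-ι̂ _)

    scalar̂-^ : ∀ x n → scalar̂ (x ^ᴷ n) ≈ scalar̂ x ^ n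
    scalar̂-^ x zero    = scalar̂-1
    scalar̂-^ x (suc n) = trans (scalar̂-* x _) (*-congˡ (scalar̂-^ x n))

    a b q : Carrier
    a = scalar̂ t½
    b = scalar̂ t⁻½
    q = scalar̂ (t½ K.- t⁻½)

    a≈b+q : a ≈ b + q
    a≈b+q = trans (scalar̂-cong (K.sym (K.trans (K.+-comm _ _) (K.trans (K.+-assoc _ _ _)
      (K.trans (K.+-congˡ (K.-‿inverseˡ t⁻½)) (K.+-identityʳ t½)))))) (scalar̂-+ _ _)

    ab≈1 : a * b ≈ 1#
    ab≈1 = trans (sym (scalar̂-* _ _)) (trans (scalar̂-cong t½*t⁻½≈1) scalar̂-1)

    -- Exponents being nonpositive, β is the image of the inverse u⁻¹: b for `𝟏₀`, -a for `ε₀`, and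
    -- -1 for the alternating sum.
    weighted-sum : ∀ u u⁻¹ {β} → scalar̂ u⁻¹ ≈ β → (g : Fin m → Carrier) →
                   ∑ (λ w → scalar̂ (zpow u u⁻¹ (ℓ-ℓ₀ w)) * Localized.along v g w) ≈ weighted β g
    weighted-sum u u⁻¹ {β} u⁻¹≈β g = sum-cong (λ w → *-congʳ (begin
      scalar̂ (zpow u u⁻¹ (ℓ-ℓ₀ w))                ≡⟨ ≡.cong scalar̂ (zpow-ℓ u u⁻¹ (w₀-longest w)) ⟩
      scalar̂ (u⁻¹ ^ᴷ (len w₀′ ∸ len w))           ≈⟨ scalar̂-^ u⁻¹ (len w₀′ ∸ len w) ⟩
      scalar̂ u⁻¹ ^ (len w₀′ ∸ len w)              ≈⟨ ^-congˡ (len w₀′ ∸ len w) u⁻¹≈β ⟩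
      β ^ (len w₀′ ∸ len w)                       ∎)) (elements (suc m))
      where w₀′ = w₀ {suc m}

    symmetrizer-weighted : ∀ g → symmetrizer g ≈ weighted 1# g
    symmetrizer-weighted g = sum-cong
      (λ w → sym (trans (*-congʳ (1^n≈1 (len (w₀ {suc m}) ∸ len w))) (*-identityˡ _))) (elements (suc m))

    ι̂-binomial : ∀ x y i j → i ≢ j →
                 ι̂ (evaluate (binomial x y i j)) ≈ scalar̂ x - scalar̂ y * (ι̂ (gen (Z i)) * ι̂ (gen (Z⁻¹ j)))
    ι̂-binomial x y i j i≢j = begin
      ι̂ (evaluate (binomial x y i j))                         ≈⟨ ι̂-cong (evaluate-binomial x y i j i≢j) ⟩
      ι̂ (_ H.+ H.- (gen (scalar y) H.* (gen (Z i) H.* gen (Z⁻¹ j))))   ≈⟨ ι̂-+ _ _ ⟩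
      scalar̂ x + ι̂ (H.- (gen (scalar y) H.* (gen (Z i) H.* gen (Z⁻¹ j))))   ≈⟨ +-congˡ (-ι̂ _) ⟩
      scalar̂ x - ι̂ (gen (scalar y) H.* (gen (Z i) H.* gen (Z⁻¹ j)))
        ≈⟨ +-congˡ (-‿cong (trans (ι̂-* _ _) (*-congˡ (ι̂-* _ _)))) ⟩
      scalar̂ x - scalar̂ y * (ι̂ (gen (Z i)) * ι̂ (gen (Z⁻¹ j)))  ∎

    num : Σ Laurent Nonzero → Carrier
    num f = ι̂ (evaluate (proj₁ f))

    num-invˡ : ∀ f → gen (inv f) * num f ≈ 1#
    num-invˡ f = relation (Relation̂.invˡ f)

    num-invʳ : ∀ f → num f * gen (inv f) ≈ 1#
    num-invʳ f = relation (Relation̂.invʳ f)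

    Z̃ Z̃⁻¹ : Fin (suc m) → Carrier
    Z̃   i = ι̂ (gen (Z i))
    Z̃⁻¹ i = ι̂ (gen (Z⁻¹ i))

    Z̃-Z̃⁻¹ : ∀ i j → Z̃ i * Z̃⁻¹ j ≈ Z̃⁻¹ j * Z̃ i
    Z̃-Z̃⁻¹ i j = ι̂-exchange (Z-Z⁻¹ i j)

    ι̂-numerator : ∀ i j i≢j → num (numerator i j i≢j) ≈ b - a * (Z̃ i * Z̃⁻¹ j)
    ι̂-numerator = ι̂-binomial t⁻½ t½

    ι̂-denominator : ∀ i j i≢j → num (denominator i j i≢j) ≈ 1# - Z̃ i * Z̃⁻¹ j
    ι̂-denominator i j i≢j = trans (ι̂-binomial K.1# K.1# i j i≢j)
      (+-cong scalar̂-1 (-‿cong (trans (*-congʳ scalar̂-1) (*-identityˡ _))))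

    private
      -- The factors of ∏[i<j] come from a local function, recovered here by unification.
      ∏[i<j]-factor : ∀ f → Σ (Fin (suc m) → Fin (suc m) → Carrier) λ F →
        ∏[i<j] f ≡ product (map (λ i → product (map (F i) (allFin (suc m)))) (allFin (suc m)))
      ∏[i<j]-factor f = _ , ≡.refl

      factor : (∀ i j → i ≢ j → Carrier) → Fin (suc m) → Fin (suc m) → Carrier
      factor f = proj₁ (∏[i<j]-factor f)

      factor-< : ∀ f i j (i<j : i Fin.< j) → factor f i j ≡ f i j (Fin.<⇒≢ i<j)
      factor-< f i j i<j with i Fin.<? j
      ... | yes _   = ≡.refl
      ... | no  i≮j = contradiction i<j i≮j

      factor-≮ : ∀ f i j → ¬ (i Fin.< j) → factor f i j ≡ 1#
      factor-≮ f i j i≮j with i Fin.<? j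
      ... | yes i<j = contradiction i<j i≮j
      ... | no  _   = ≡.refl

    ∏[i<j]≈∏< : ∀ {f G} → (∀ i j i≢j → f i j i≢j ≈ G i j) → ∏[i<j] f ≈ ∏< G
    ∏[i<j]≈∏< {f} {G} f≈G = begin
      ∏[i<j] f                       ≈⟨ ∏-allFin (λ i → product (map (factor f i) (allFin (suc m)))) ⟩
      ∏ (λ i → product (map (factor f i) (allFin (suc m))))  ≈⟨ ∏-cong (λ i → ∏-allFin (factor f i)) ⟩
      ∏ (λ i → ∏ (factor f i))       ≈⟨ ∏∏≈∏< (λ i j i<j → trans (reflexive (factor-< f i j i<j)) (f≈G i j _))
                                              (λ i j i≮j → reflexive (factor-≮ f i j i≮j)) ⟩
      ∏< G                           ∎

    open LocalizedFactorizations Ĥ q (scalar̂-central _) a b (scalar̂-central _) (scalar̂-central _) a≈b+q ab≈1 public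
      using (Coordinates; module Coordinates; module Factorization)

    T̂-braid : ∀ i j → toℕ j ≡ suc (toℕ i) → T̂ i * T̂ j * T̂ i ≈ T̂ j * T̂ i * T̂ j
    T̂-braid i j eq = trans (sym (trans (ι̂-* _ _) (*-congʳ (ι̂-* _ _))))
      (trans (ι̂-cong (Presented.relation (braid i j eq))) (trans (ι̂-* _ _) (*-congʳ (ι̂-* _ _))))

    T̂-quadratic : ∀ i → T̂ i * T̂ i ≈ q * T̂ i + 1#
    T̂-quadratic i = trans (sym (ι̂-* _ _)) (trans (ι̂-cong (Presented.relation (quadratic i)))
      (trans (ι̂-+ _ _) (+-cong (ι̂-* _ _) ι̂-1)))

    module _ (coordinates : Coordinates T̂) where

      open Coordinates coordinates using (ξ) renaming (c to cᵂ)
      open Factorization coordinates using (ĉ; c≈ĉ; weighted-b-factors; weighted-a-factors)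

      𝟏₀-factors : 𝟏₀ ≈ symmetrizer ξ * ∏[i<j] (λ i j i≢j → cᵂ j i (i≢j ∘ ≡.sym))
      𝟏₀-factors = begin
        𝟏₀                                      ≈⟨ weighted-sum t½ t⁻½ refl T̂ ⟩
        weighted b T̂                            ≈⟨ weighted-b-factors ⟩
        weighted 1# ξ * ∏< (λ i j → ĉ j i)      ≈⟨ *-cong (symmetrizer-weighted ξ)
                                                     (∏[i<j]≈∏< (λ i j i≢j → c≈ĉ j i (i≢j ∘ ≡.sym))) ⟨
        symmetrizer ξ * ∏[i<j] (λ i j i≢j → cᵂ j i (i≢j ∘ ≡.sym))  ∎

      ε₀-factors : ε₀ ≈ ∏[i<j] cᵂ * antisymmetrizer ξ
      ε₀-factors = begin
        ε₀                                 ≈⟨ weighted-sum (K.- t⁻½) (K.- t½) (-scalar̂ t½) T̂ ⟩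
        weighted (- a) T̂                   ≈⟨ weighted-a-factors ⟩
        ∏< ĉ * weighted (- 1#) ξ           ≈⟨ *-cong (∏[i<j]≈∏< c≈ĉ)
                                                (weighted-sum (K.- K.1#) (K.- K.1#) (trans (-scalar̂ K.1#) (-‿cong scalar̂-1)) ξ) ⟨
        ∏[i<j] cᵂ * antisymmetrizer ξ      ∎

  X-coordinates : LocalizedAlgebra.Coordinates X (Localized.T̂ X)
  X-coordinates = record
    { braid     = T̂-braid
    ; far       = λ i j 1<∣i-j∣ → ι̂-exchange (relation (far i j 1<∣i-j∣))
    ; quadratic = T̂-quadratic
    ; W         = Z̃
    ; W⁻¹       = Z̃⁻¹
    ; W-comm    = λ i j → ι̂-exchange (relation (Z-comm i j))
    ; W*W⁻¹≈1   = λ i → ι̂-inverse (relation (Z-invʳ i))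
    ; W⁻¹*W≈1   = λ i → ι̂-inverse (relation (Z-invˡ i))
    ; T-W       = λ i j j≢i j≢i+1 → ι̂-exchange (relation (T-Z i j j≢i j≢i+1))
    ; TWT≈W     = λ i → trans (*-congʳ (sym (ι̂-* _ _)))
                    (trans (sym (ι̂-* _ _)) (sym (ι̂-cong (relation (T-X-T i)))))
    ; N         = λ i j i≢j → num (numerator i j i≢j)
    ; N⁻¹       = λ i j i≢j → gen (inv (numerator i j i≢j))
    ; D         = λ i j i≢j → num (denominator i j i≢j)
    ; D⁻¹       = λ i j i≢j → gen (inv (denominator i j i≢j))
    ; N-def     = ι̂-numerator
    ; D-def     = ι̂-denominator
    ; N*N⁻¹≈1   = λ i j i≢j → num-invʳ (numerator i j i≢j)
    ; N⁻¹*N≈1   = λ i j i≢j → num-invˡ (numerator i j i≢j)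
    ; D*D⁻¹≈1   = λ i j i≢j → num-invʳ (denominator i j i≢j)
    ; D⁻¹*D≈1   = λ i j i≢j → num-invˡ (denominator i j i≢j)
    }
    where
    open LocalizedAlgebra X
      using (ι̂-cong; ι̂-*; ι̂-exchange; ι̂-inverse; T̂-braid; T̂-quadratic; Z̃; Z̃⁻¹;
             num; num-invˡ; num-invʳ; ι̂-numerator; ι̂-denominator)
    open Localized X using (Ĥ; inv; numerator; denominator)
    open Ring Ĥ using (sym; trans; *-congʳ)
    open Presented (HeckeRelation X) using (relation)

  -- The ratio W_i / W_j is now Y_j / Y_i, so numerators and denominators are taken at the
  -- transposed pair. Thus c_ij in W is c_ji in Y: ξ becomes η, and `c-w₀` and `c-w₀-inverted` trade
  -- places.
  Y-coordinates : LocalizedAlgebra.Coordinates Y (Localized.T̂ Y)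
  Y-coordinates = record
    { braid     = T̂-braid
    ; far       = λ i j 1<∣i-j∣ → ι̂-exchange (relation (far i j 1<∣i-j∣))
    ; quadratic = T̂-quadratic
    ; W         = Z̃⁻¹
    ; W⁻¹       = Z̃
    ; W-comm    = λ i j → ι̂-exchange (Polynomials.Z⁻¹-comm Y i j)
    ; W*W⁻¹≈1   = λ i → ι̂-inverse (relation (Z-invˡ i))
    ; W⁻¹*W≈1   = λ i → ι̂-inverse (relation (Z-invʳ i))
    ; T-W       = λ i j j≢i j≢i+1 → intertwines-inverse
                    (ι̂-inverse (relation (Z-invʳ j))) (ι̂-inverse (relation (Z-invˡ j)))
                    (ι̂-exchange (relation (T-Z i j j≢i j≢i+1)))
    ; TWT≈W     = λ i → conjugate-inverse (ι̂-inverse (T⁻¹-inverseʳ Y i)) (ι̂-inverse (relation (Z-invˡ (inject₁ i))))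
                    (ι̂-inverse (relation (Z-invʳ (suc i))))
                    (trans (ι̂-cong (relation (T⁻¹-Y-T⁻¹ i))) (trans (ι̂-* _ _) (*-congʳ (ι̂-* _ _))))
    ; N         = λ i j i≢j → num (numerator j i (i≢j ∘ ≡.sym))
    ; N⁻¹       = λ i j i≢j → gen (inv (numerator j i (i≢j ∘ ≡.sym)))
    ; D         = λ i j i≢j → num (denominator j i (i≢j ∘ ≡.sym))
    ; D⁻¹       = λ i j i≢j → gen (inv (denominator j i (i≢j ∘ ≡.sym)))
    ; N-def     = λ i j i≢j → trans (ι̂-numerator j i (i≢j ∘ ≡.sym)) (+-congˡ (-‿cong (*-congˡ (Z̃-Z̃⁻¹ j i))))
    ; D-def     = λ i j i≢j → trans (ι̂-denominator j i (i≢j ∘ ≡.sym)) (+-congˡ (-‿cong (Z̃-Z̃⁻¹ j i)))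
    ; N*N⁻¹≈1   = λ i j i≢j → num-invʳ (numerator j i (i≢j ∘ ≡.sym))
    ; N⁻¹*N≈1   = λ i j i≢j → num-invˡ (numerator j i (i≢j ∘ ≡.sym))
    ; D*D⁻¹≈1   = λ i j i≢j → num-invʳ (denominator j i (i≢j ∘ ≡.sym))
    ; D⁻¹*D≈1   = λ i j i≢j → num-invˡ (denominator j i (i≢j ∘ ≡.sym))
    }
    where
    open LocalizedAlgebra Y
      using (ι̂-cong; ι̂-*; ι̂-exchange; ι̂-inverse; T̂-braid; T̂-quadratic; Z̃; Z̃⁻¹; Z̃-Z̃⁻¹;
             num; num-invˡ; num-invʳ; ι̂-numerator; ι̂-denominator)
    open Localized Y using (Ĥ; inv; numerator; denominator)
    open Ring Ĥ using (trans; +-congˡ; -‿cong; *-congˡ; *-congʳ)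
    open RingProducts Ĥ using (intertwines-inverse; conjugate-inverse)
    open Presented (HeckeRelation Y) using (relation)

proposition3p6 : ∀ {ℓ₀ ℓ₁ ℓ₂} (K : HeytingField ℓ₀ ℓ₁ ℓ₂)
    (t½ : HeytingField.Carrier K) (t½#0 : HeytingField._#_ K t½ (HeytingField.0# K)) (m : ℕ) →
    let module X = AffineHecke.X-side K t½ t½#0 m
        module Y = AffineHecke.Y-side K t½ t½#0 m
    in (X.𝟏₀ X.≈̂ (X.p₀ X.*̂ X.c-w₀-inverted))
     × (X.ε₀ X.≈̂ (X.c-w₀ X.*̂ X.e₀))
     × (Y.𝟏₀ Y.≈̂ (Y.p₀ Y.*̂ Y.c-w₀))
     × (Y.ε₀ Y.≈̂ (Y.c-w₀-inverted Y.*̂ Y.e₀))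
-- Unfolding alone gives the stated forms: for Y the two transpositions of the indices cancel, and
-- the differing proofs of i ≢ j are definitionally equal.
proposition3p6 K t½ t½#0 m =
    LocalizedAlgebra.𝟏₀-factors X X-coordinates
  , LocalizedAlgebra.ε₀-factors X X-coordinates
  , LocalizedAlgebra.𝟏₀-factors Y Y-coordinates
  , LocalizedAlgebra.ε₀-factors Y Y-coordinates
  where
  open AffineHecke K t½ t½#0 m using (X; Y)
  open HeckeAlgebra K t½ t½#0 m
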